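{- The parity game solving problem for lossy channel games under incomplete information is undecidable: there is no algorithm that, given a lossy channel game structure with incomplete information $\mathcal G=\mathcal G(\mathcal L,C_{obs})$ and a visible priority function $pr$, determines whether there exists an $obs^+$-consistent winning strategy for $Player_\exists$ in $\mathit{Parity}(\mathcal G,pr)$.
   Context: **Partially specified lossy channel system (LCS).** A tuple $\mathcal L=(\mathcal A_0,\mathcal A_1,C,M,\Sigma_0,\Sigma_1,\Sigma_\exists)$, where $C$ is a finite set of channels, $M$ a finite set of messages, $\Sigma_0,\Sigma_1$ are disjoint finite sets of transition labels, $\Sigma=\Sigma_0\cup\Sigma_1$, $\Sigma_\exists\subseteq\Sigma_0$, and for $p\in\{0,1\}$, $\mathcal A_p=(Q_p,q_p^0,\delta_p)$ has a finite set $Q_p$ of locations, an initial location $q_p^0\in Q_p$ and a finite set $\delta_p$ of transitions $(q,a,Gr,Op,q')$ with $q,q'\in Q_p$, $a\in\Sigma_p$, $Gr:C\to\{true,(=\epsilon)\}\cup\{(\in m\cdot M^*)\mid m\in M\}$ and $Op:C\to\{nop\}\cup\{!m,?m\mid m\in M\}$. Let $W$ be the set of functions $w:C\to M^*$; a configuration is $(q_0,q_1,w)\in Q_0\times Q_1\times W$; $\epsilon\in W$ also denotes the valuation with all channels empty. Strong transitions: $(q_0,q_1,w)\xrightarrow{a}(q_0',q_1',w')$ iff, for the $p$ with $a\in\Sigma_p$, $q_{1-p}'=q_{1-p}$ and there is $(q_p,a,Gr,Op,q_p')\in\delta_p$ such that for each $c\in C$: if $Gr(c)=(\in m\cdot M^*)$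 then $w(c)\in m\cdot M^*$; if $Gr(c)=(=\epsilon)$ then $w(c)=\epsilon$; if $Op(c)=!m$ then $w'(c)=w(c)\cdot m$; if $Op(c)=?m$ then $m\cdot w'(c)=w(c)$; if $Op(c)=nop$ then $w'(c)=w(c)$. Let $\preceq$ be the (not necessarily contiguous) subword relation on $M^*$, extended channelwise to $W$. Weak transitions: $(q_0,q_1,w)\stackrel{a}{\Rightarrow}(q_0',q_1',w')$ iff there are $w_1\preceq w$ and $w_2$ with $w'\preceq w_2$ and $(q_0,q_1,w_1)\xrightarrow{a}(q_0',q_1',w_2)$. **LC-game structure.** Let $C_{obs}\subseteq C$ (observable channels) contain all channels occurring in guards (other than $true$) or read operations of $\mathcal A_0$. $\mathcal G(\mathcal L,C_{obs})$ has states $S=\{0,1\}\times Q_0\times Q_1\times W$ and initial states $I=\{(p,q_0^0,q_1^0,\epsilon)\mid p\in\{0,1\}\}$. For $s=(p,q_0,q_1,w)$, $s'=(p',q_0',q_1',w')$ and $a\in\Sigma$: $s\xrightarrow{a}_g s'$ (resp. $s\stackrel{a}{\Rightarrow}_g s'$) iff $a\in\Sigma_p$ and $(q_0,q_1,w)\xrightarrow{a}(q_0',q_1',w')$ (resp. $\stackrel{a}{\Rightarrow}$); $p'$ is arbitrary. $S_0$ is the set of states with first component $0$, and $S_1=S\setminus S_0$. **Observations.** $H_{obs}$ is the set of functions $C_{obs}\to M\cup\{\epsilon\}$, $Obs=\{0,1\}\times Q_0\times H_{obs}$, and $obs(p,q_0,q_1,w)=(p,q_0,h)$ where, for $c\in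 C_{obs}$, $h(c)=\epsilon$ if $p=1$ or $w(c)=\epsilon$, and otherwise $h(c)$ is the first letter of $w(c)$. For $s\in S_0$ let $Enabled(s)=\{a\in\Sigma_0\mid\exists s'.\ s\xrightarrow{a}_g s'\}$; it depends only on $o=obs(s)$ and is written $Enabled(o)$. Put $\Sigma_\exists^\bot=\Sigma_\exists\cup\{\bot\}$. $Act_\exists(o)$ consists of $Enabled(o)\cap\Sigma_\exists$, together with $\bot$ if $Enabled(o)\cap\Sigma_\exists=\emptyset$ or $Enabled(o)\cap(\Sigma_0\setminus\Sigma_\exists)\neq\emptyset$. For $a^\exists\in\Sigma_\exists^\bot$, $Act_\forall(o,a^\exists)=(\{a^\exists\}\cap\Sigma_\exists)\cup(Enabled(o)\setminus\Sigma_\exists)$. **Plays and strategies.** A play is a finite or infinite sequence $s_0a_0^\exists a_0s_1a_1^\exists a_1\ldots$ with $s_i\in S$, $a_i^\exists\in\Sigma_\exists^\bot$, $a_i\in\Sigma$, $s_0\in I$, $s_i\stackrel{a_i}{\Rightarrow}_g s_{i+1}$; if $s_i\in S_1$ then $a_i^\exists=\bot$; if $s_i\in S_0$ then $a_i^\exists\in Act_\exists(obs(s_i))$ and $a_i\in Act_\forall(obs(s_i),a_i^\exists)$; a play is finite (ending in a state) only if it cannot be extended. $\mathsf{Prefs}_\exists(\mathcal G)$ is the set of finite prefixes of plays ending in a state of $S_0$; $last(\pi)$ is the last state of $\pi$. A strategy for $Player_\exists$ is a total function $f_\exists:\mathsf{Prefs}_\exists(\mathcal G)\to\Sigma_\exists^\bot$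 with $f_\exists(\pi)\in Act_\exists(obs(last(\pi)))$. $\mathsf{Outcome}(f_\exists)$ is the set of plays with $a_i^\exists=f_\exists(s_0a_0^\exists a_0\ldots s_i)$ whenever $s_i\in S_0$. For $\pi\in\mathsf{Prefs}_\exists(\mathcal G)$, $obs^+(\pi)\in(Obs\cdot\Sigma_0)^*\cdot Obs$ is obtained from $\pi$ by deleting all $a_i^\exists$, all states in $S_1$ and all labels in $\Sigma_1$, and replacing each state $s\in S_0$ by $obs(s)$. $f_\exists$ is $obs^+$-consistent if $obs^+(\pi_1)=obs^+(\pi_2)$ implies $f_\exists(\pi_1)=f_\exists(\pi_2)$. **Parity games.** A visible priority function is $pr:Obs\to\{0,1,\ldots,n\}$, $n\in\mathbb N$. For an infinite play $\pi$, $pr(\pi)=\min\{pr(o)\mid o\in InfObs(\pi)\}$, where $InfObs(\pi)$ is the set of observations $o$ such that $obs(s_i)=o$ for infinitely many states $s_i$ of $\pi$. In $\mathit{Parity}(\mathcal G,pr)$, $f_\exists$ is winning iff $pr(\pi)$ is even for every infinite $\pi\in\mathsf{Outcome}(f_\exists)$. -}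

module Defs where

open import Data.Bool.Base using (Bool; true; false; if_then_else_)
open import Data.Empty using (⊥)
open import Data.Fin.Base using (Fin; toℕ)
open import Data.Fin.Subset using (Subset; ∣_∣; inside; outside)
  renaming (_∈_ to _∈ˢ_; _∉_ to _∉ˢ_)
open import Data.List.Base
  using (List; []; _∷_; [_]; _++_; _∷ʳ_; head; map; concatMap; replicate; allFin)
open import Data.List.Membership.Propositional using (_∈_)
open import Data.List.Relation.Binary.Sublist.Propositional using (_⊆_)
open import Data.Maybe.Base using (Maybe; just; nothing)
open import Data.Nat.Base using (ℕ; zero; suc; _≤_)
open import Data.Nat.Divisibility using (_∣_)
open import Data.Product.Base using (Σ; Σ-syntax; ∃; ∃-syntax; _×_; _,_; proj₁; proj₂)
open import Data.Sum.Base using (_⊎_; inj₁; inj₂)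
open import Data.Unit.Base using (⊤)
import Data.Vec.Base as Vec
open Vec using (Vec; []; _∷_; lookup)
open import Relation.Binary.PropositionalEquality using (_≡_; _≢_)
open import Relation.Nullary.Negation using (¬_)

------------------------------------------------------------------------
-- Lossy channel systems

-- All finite sets are of the form Fin n, so that a game is a finite object
-- that can be given to an algorithm.

data Guard (m : ℕ) : Set where
  any    : Guard m
  empty  : Guard m
  starts : Fin m → Guard m

data Op (m : ℕ) : Set where
  nop  : Op m
  send : Fin m → Op m
  recv : Fin m → Op m

record Transition (channels messages labels locations : ℕ) : Set where
  constructor transition
  field
    source : Fin locations
    label  : Fin labels
    guard  : Vec (Guard messages) channels
    op     : Vec (Op messages) channels
    target : Fin locations

record Automaton (channels messages labels : ℕ) : Set where
  field
    locations : ℕ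
    initial   : Fin locations
    δ         : List (Transition channels messages labels locations)

record LCS : Set where
  field
    channels messages : ℕ
    labels₀ labels₁   : ℕ
    𝒜₀ : Automaton channels messages labels₀
    𝒜₁ : Automaton channels messages labels₁
    Σ∃ : Subset labels₀

  module 𝒜₀ = Automaton 𝒜₀
  module 𝒜₁ = Automaton 𝒜₁

  Q₀ Q₁ Message Label₀ Label₁ Label : Set
  Q₀      = Fin 𝒜₀.locations
  Q₁      = Fin 𝒜₁.locations
  Message = Fin messages
  Label₀  = Fin labels₀
  Label₁  = Fin labels₁
  Label   = Label₀ ⊎ Label₁

  W : Set
  W = Vec (List Message) channels

  ε : W
  ε = Vec.replicate channels []

  Config : Set
  Config = Q₀ × Q₁ × W

  GuardHolds : Guard messages → List Message → Set
  GuardHolds any        u = ⊤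
  GuardHolds empty      u = u ≡ []
  GuardHolds (starts m) u = ∃[ v ] u ≡ m ∷ v

  OpRelates : Op messages → List Message → List Message → Set
  OpRelates nop      u u′ = u′ ≡ u
  OpRelates (send m) u u′ = u′ ≡ u ∷ʳ m
  OpRelates (recv m) u u′ = m ∷ u′ ≡ u

  Fires : ∀ {k l} → List (Transition channels messages k l) →
          Fin l → W → Fin k → Fin l → W → Set
  Fires δ q w a q′ w′ =
    ∃[ gr ] ∃[ op ] transition q a gr op q′ ∈ δ ×
      (∀ c → GuardHolds (lookup gr c) (lookup w c) ×
             OpRelates (lookup op c) (lookup w c) (lookup w′ c))

  Strong : Config → Label → Config → Set
  Strong (q₀ , q₁ , w) (inj₁ a) (q₀′ , q₁′ , w′) = q₁′ ≡ q₁ × Fires 𝒜₀.δ q₀ w a q₀′ w′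
  Strong (q₀ , q₁ , w) (inj₂ a) (q₀′ , q₁′ , w′) = q₀′ ≡ q₀ × Fires 𝒜₁.δ q₁ w a q₁′ w′

  -- In the standard library, xs ⊆ ys on lists is the scattered-subword order.
  _≼_ : W → W → Set
  w ≼ w′ = ∀ c → lookup w c ⊆ lookup w′ c

  Weak : Config → Label → Config → Set
  Weak (q₀ , q₁ , w) a (q₀′ , q₁′ , w′) =
    ∃[ w₁ ] ∃[ w₂ ] w₁ ≼ w × w′ ≼ w₂ × Strong (q₀ , q₁ , w₁) a (q₀′ , q₁′ , w₂)

------------------------------------------------------------------------
-- Lossy channel games under incomplete information

data Player : Set where
  P₀ P₁ : Player

-- Vec A ∣ p ∣ represents the functions from the subset p to A.
restrict : ∀ {A : Set} {n} (p : Subset n) → Vec A n → Vec A ∣ p ∣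
restrict []            []       = []
restrict (inside  ∷ p) (x ∷ xs) = x ∷ restrict p xs
restrict (outside ∷ p) (x ∷ xs) = restrict p xs

record GameStructure : Set where
  field
    lcs : LCS
  open LCS lcs public
  field
    Cobs : Subset channels
    Cobs-guards : ∀ {q a gr op q′} → transition q a gr op q′ ∈ 𝒜₀.δ →
                  ∀ c → lookup gr c ≢ any → c ∈ˢ Cobs
    Cobs-reads  : ∀ {q a gr op q′} → transition q a gr op q′ ∈ 𝒜₀.δ →
                  ∀ c m → lookup op c ≡ recv m → c ∈ˢ Cobs

  State : Set
  State = Player × Config

  turn : State → Player
  turn = proj₁

  Initial : State → Set
  Initial (p , s) = s ≡ (𝒜₀.initial , 𝒜₁.initial , ε)

  owner : Label → Player
  owner (inj₁ _) = P₀
  owner (inj₂ _) = P₁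

  StrongG WeakG : State → Label → State → Set
  StrongG (p , s) a (p′ , s′) = owner a ≡ p × Strong s a s′
  WeakG   (p , s) a (p′ , s′) = owner a ≡ p × Weak s a s′

  HObs : Set
  HObs = Vec (Maybe Message) ∣ Cobs ∣

  Obs : Set
  Obs = Player × Q₀ × HObs

  obs : State → Obs
  obs (P₀ , q₀ , q₁ , w) = P₀ , q₀ , restrict Cobs (Vec.map head w)
  obs (P₁ , q₀ , q₁ , w) = P₁ , q₀ , Vec.replicate _ nothing

  -- Whether a label is enabled in a state s ∈ S₀ depends only on obs s, so
  -- "in some s ∈ S₀ with observation o" and "in every such s" coincide on
  -- observations of states in S₀.
  Enabled : Obs → Label₀ → Set
  Enabled o a = ∃[ s ] turn s ≡ P₀ × obs s ≡ o × ∃[ s′ ] StrongG s (inj₁ a) s′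

  -- Choices are the elements of Σ∃ ∪ {⊥}, with ⊥ represented by nothing; that
  -- a choice just a has a ∈ Σ∃ is enforced by Act∃.
  Choice : Set
  Choice = Maybe Label₀

  Act∃ : Obs → Choice → Set
  Act∃ o (just a) = Enabled o a × a ∈ˢ Σ∃
  Act∃ o nothing  = ¬ (∃[ a ] Enabled o a × a ∈ˢ Σ∃) ⊎ (∃[ a ] Enabled o a × a ∉ˢ Σ∃)

  Act∀ : Obs → Choice → Label₀ → Set
  Act∀ o a∃ a = (a∃ ≡ just a × a ∈ˢ Σ∃) ⊎ (Enabled o a × a ∉ˢ Σ∃)

  -- For s ∈ S₁ the label is restricted only by WeakG.
  Permitted : State → Choice → Label → Set
  Permitted (P₁ , _)   a∃ a        = a∃ ≡ nothing
  Permitted s@(P₀ , _) a∃ (inj₁ a) = Act∃ (obs s) a∃ × Act∀ (obs s) a∃ a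
  Permitted (P₀ , _)   a∃ (inj₂ a) = ⊥

  Move : State → Choice → Label → State → Set
  Move s a∃ a s′ = Permitted s a∃ a × WeakG s a s′

  ----------------------------------------------------------------------
  -- Plays

  infixl 5 _·_·_·_
  data FinSeq : Set where
    ⟨_⟩     : State → FinSeq
    _·_·_·_ : FinSeq → Choice → Label → State → FinSeq

  record InfSeq : Set where
    field
      state  : ℕ → State
      choice : ℕ → Choice
      label  : ℕ → Label
  open InfSeq public

  Seq : Set
  Seq = FinSeq ⊎ InfSeq

  last : FinSeq → State
  last ⟨ s ⟩           = s
  last (π · a∃ · a · s) = s

  prefix : InfSeq → ℕ → FinSeq
  prefix ρ zero    = ⟨ state ρ zero ⟩
  prefix ρ (suc n) = prefix ρ n · choice ρ n · label ρ n · state ρ (suc n)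

  -- Only prefixes ending in a state occur.
  infix 4 _⊑ᶠ_ _⊑_
  data _⊑ᶠ_ (π : FinSeq) : FinSeq → Set where
    here  : π ⊑ᶠ π
    there : ∀ {ρ a∃ a s} → π ⊑ᶠ ρ → π ⊑ᶠ (ρ · a∃ · a · s)

  _⊑_ : FinSeq → Seq → Set
  π ⊑ inj₁ ρ = π ⊑ᶠ ρ
  π ⊑ inj₂ ρ = ∃[ n ] π ≡ prefix ρ n

  FollowsRules : FinSeq → Set
  FollowsRules ⟨ s ⟩            = Initial s
  FollowsRules (π · a∃ · a · s) = FollowsRules π × Move (last π) a∃ a s

  IsPlay : Seq → Set
  IsPlay (inj₁ π) = FollowsRules π × ¬ (∃[ a∃ ] ∃[ a ] ∃[ s ] Move (last π) a∃ a s)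
  IsPlay (inj₂ ρ) =
    Initial (state ρ 0) × (∀ i → Move (state ρ i) (choice ρ i) (label ρ i) (state ρ (suc i)))

  Prefs∃ : FinSeq → Set
  Prefs∃ π = turn (last π) ≡ P₀ × ∃[ ρ ] IsPlay ρ × π ⊑ ρ

  ----------------------------------------------------------------------
  -- Strategies

  -- The irrelevant argument makes a strategy a function of the sequence alone,
  -- defined on Prefs∃.
  record Strategy : Set where
    field
      choose  : (π : FinSeq) → .(Prefs∃ π) → Choice
      allowed : ∀ π (p : Prefs∃ π) → Act∃ (obs (last π)) (choose π p)
  open Strategy public

  Outcome : Strategy → Seq → Set
  Outcome f ρ =
    IsPlay ρ ×
    (∀ π a∃ a s → (π · a∃ · a · s) ⊑ ρ → (p : Prefs∃ π) → a∃ ≡ choose f π p)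

  visibleState : State → List (Obs ⊎ Label₀)
  visibleState s@(P₀ , _) = [ inj₁ (obs s) ]
  visibleState   (P₁ , _) = []

  visibleLabel : Label → List (Obs ⊎ Label₀)
  visibleLabel (inj₁ a) = [ inj₂ a ]
  visibleLabel (inj₂ a) = []

  obs⁺ : FinSeq → List (Obs ⊎ Label₀)
  obs⁺ ⟨ s ⟩            = visibleState s
  obs⁺ (π · a∃ · a · s) = obs⁺ π ++ visibleLabel a ++ visibleState s

  Consistent : Strategy → Set
  Consistent f = ∀ π₁ π₂ (p₁ : Prefs∃ π₁) (p₂ : Prefs∃ π₂) →
                 obs⁺ π₁ ≡ obs⁺ π₂ → choose f π₁ p₁ ≡ choose f π₂ p₂

------------------------------------------------------------------------
-- Parity games with visible priorities

record ParityGame : Set where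
  field
    structure : GameStructure
  open GameStructure structure public
  field
    maxPriority : ℕ
    pr          : Obs → Fin (suc maxPriority)

  InfObs : InfSeq → Obs → Set
  InfObs ρ o = ∀ n → ∃[ i ] n ≤ i × obs (state ρ i) ≡ o

  -- k = min { pr o ∣ o ∈ InfObs ρ }.  Classically every infinite ρ has exactly
  -- one such k, because Obs is finite.
  HasPriority : InfSeq → ℕ → Set
  HasPriority ρ k = (∃[ o ] InfObs ρ o × toℕ (pr o) ≡ k) ×
                    (∀ o → InfObs ρ o → k ≤ toℕ (pr o))

  Winning : Strategy → Set
  Winning f = ∀ ρ → Outcome f (inj₂ ρ) → ∀ k → HasPriority ρ k → 2 ∣ k

HasConsistentWinningStrategy : ParityGame → Set
HasConsistentWinningStrategy G = ∃[ f ] Consistent f × Winning f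
  where open ParityGame G

------------------------------------------------------------------------
-- Presenting a parity game to an algorithm

-- A game is written as a list of numbers, and a list of numbers as a binary
-- word, n being written 1ⁿ0.  Each component below has a self-delimiting code
-- once the numbers written before it are known, so a game can be read off its
-- code (up to the proofs that Cobs is large enough, which are not coded).

encodeFin : ∀ {n} → Fin n → List ℕ
encodeFin i = [ toℕ i ]

encodeList : ∀ {A : Set} → (A → List ℕ) → List A → List ℕ
encodeList f []       = [ 0 ]
encodeList f (x ∷ xs) = 1 ∷ f x ++ encodeList f xs

encodeVec : ∀ {A : Set} {n} → (A → List ℕ) → Vec A n → List ℕ
encodeVec f xs = concatMap f (Vec.toList xs)

encodeSubset : ∀ {n} → Subset n → List ℕ
encodeSubset = encodeVec λ b → if b then [ 1 ] else [ 0 ]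

encodeGuard : ∀ {m} → Guard m → List ℕ
encodeGuard any        = [ 0 ]
encodeGuard empty      = [ 1 ]
encodeGuard (starts m) = 2 ∷ encodeFin m

encodeOp : ∀ {m} → Op m → List ℕ
encodeOp nop      = [ 0 ]
encodeOp (send m) = 1 ∷ encodeFin m
encodeOp (recv m) = 2 ∷ encodeFin m

encodeTransition : ∀ {c m k l} → Transition c m k l → List ℕ
encodeTransition (transition q a gr op q′) =
  encodeFin q ++ encodeFin a ++ encodeVec encodeGuard gr ++ encodeVec encodeOp op ++
  encodeFin q′

encodeAutomaton : ∀ {c m k} → Automaton c m k → List ℕ
encodeAutomaton 𝒜 = locations ∷ encodeFin initial ++ encodeList encodeTransition δ
  where open Automaton 𝒜

allVecs : ∀ {A : Set} → List A → (n : ℕ) → List (Vec A n)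
allVecs xs zero    = [ [] ]
allVecs xs (suc n) = concatMap (λ x → map (x ∷_) (allVecs xs n)) xs

allObs : (G : GameStructure) → List (GameStructure.Obs G)
allObs G =
  concatMap (λ p → concatMap (λ q → map (λ h → p , q , h)
    (allVecs (nothing ∷ map just (allFin messages)) ∣ Cobs ∣))
    (allFin 𝒜₀.locations))
    (P₀ ∷ P₁ ∷ [])
  where open GameStructure G

encodeParityGame : ParityGame → List ℕ
encodeParityGame G =
  channels ∷ messages ∷ labels₀ ∷ labels₁ ∷
  encodeAutomaton 𝒜₀ ++ encodeAutomaton 𝒜₁ ++ encodeSubset Σ∃ ++ encodeSubset Cobs ++
  maxPriority ∷ concatMap (λ o → encodeFin (pr o)) (allObs structure)
  where open ParityGame G

encode : ParityGame → List Bool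
encode G = concatMap (λ n → replicate n true ∷ʳ false) (encodeParityGame G)

------------------------------------------------------------------------
-- Algorithms: deterministic Turing machines with one two-way infinite tape

data Verdict : Set where
  accept reject : Verdict

data Direction : Set where
  left right : Direction

data Symbol (extra : ℕ) : Set where
  blank : Symbol extra
  bit   : Bool → Symbol extra
  aux   : Fin extra → Symbol extra

record TuringMachine : Set where
  field
    controls : ℕ
    start    : Fin controls
    extra    : ℕ

  Γ : Set
  Γ = Symbol extra

  field
    δ : Fin controls → Γ → Verdict ⊎ (Fin controls × Γ × Direction)

  -- The two lists are the tape to the left and to the right of the scanned
  -- cell, nearest cell first; all cells beyond them are blank.
  record TMConfig : Set where
    constructor _◂_◂_◂_
    field
      control : Fin controls
      before  : List Γ
      scanned : Γ
      after   : List Γ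

  move : Fin controls → List Γ → Γ → List Γ → Direction → TMConfig
  move q []       x ys       left  = q ◂ [] ◂ blank ◂ (x ∷ ys)
  move q (y ∷ xs) x ys       left  = q ◂ xs ◂ y ◂ (x ∷ ys)
  move q xs       x []       right = q ◂ (x ∷ xs) ◂ blank ◂ []
  move q xs       x (y ∷ ys) right = q ◂ (x ∷ xs) ◂ y ◂ ys

  data HaltsWith (v : Verdict) : TMConfig → Set where
    halt : ∀ {q xs x ys} → δ q x ≡ inj₁ v → HaltsWith v (q ◂ xs ◂ x ◂ ys)
    step : ∀ {q xs x ys q′ x′ d} → δ q x ≡ inj₂ (q′ , x′ , d) →
           HaltsWith v (move q′ xs x′ ys d) → HaltsWith v (q ◂ xs ◂ x ◂ ys)

  initialConfig : List Bool → TMConfig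
  initialConfig []      = start ◂ [] ◂ blank ◂ []
  initialConfig (b ∷ u) = start ◂ [] ◂ bit b ◂ map bit u

  Accepts Rejects : List Bool → Set
  Accepts u = HaltsWith accept (initialConfig u)
  Rejects u = HaltsWith reject (initialConfig u)

Decides : ∀ {A : Set} → TuringMachine → (A → List Bool) → (A → Set) → Set
Decides T code P = ∀ x → (Accepts (code x) × P x) ⊎ (Rejects (code x) × ¬ P x)
  where open TuringMachine T

Undecidable : ∀ {A : Set} → (A → List Bool) → (A → Set) → Set
Undecidable code P = ¬ (Σ[ T ∈ TuringMachine ] Decides T code P)

{-# OPTIONS --safe #-}
module Submission where

open import Defs
open import Data.Bool.Base using (Bool; true; false)
open import Data.Empty using (⊥; ⊥-elim)
open import Data.Fin.Base using (Fin; zero; suc; toℕ; _↑ˡ_; _↑ʳ_; splitAt)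
open import Data.Fin.Patterns
open import Data.Fin.Properties using (splitAt-↑ˡ; splitAt-↑ʳ; toℕ-↑ˡ; ∀-cons)
open import Data.Fin.Subset using (⊤) renaming (⊥ to ∅; ∣_∣ to card)
open import Data.Fin.Subset.Properties using (∈⊤; ∉⊥)
open import Data.List.Base
  using (List; []; _∷_; _++_; _∷ʳ_; length; map; concat; concatMap; allFin; replicate; reverse;
         foldl; foldr)
open import Data.List.Membership.Propositional using (_∈_)
open import Data.List.Membership.Propositional.Properties
  using (∈-++⁺ˡ; ∈-++⁺ʳ; ∈-++⁻; ∈-concatMap⁺; ∈-concatMap⁻; ∈-allFin)
open import Data.List.Properties
open import Data.List.Relation.Binary.Sublist.Heterogeneous.Properties using (length-mono-≤)
open import Data.List.Relation.Binary.Sublist.Propositional using (_⊆_; ⊆-refl)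
open import Data.List.Relation.Unary.Any using (here; there)
import Data.List.Relation.Unary.Any as Any
open import Data.Maybe.Base using (just; nothing)
open import Data.Nat.Base
open import Data.Nat.Divisibility using (_∣_; divides; ∣1⇒≡1)
open import Data.Nat.Induction using (<-wellFounded)
open import Data.Nat.Properties
open import Data.Product.Base using (∃-syntax; _×_; _,_; proj₁; proj₂)
open import Data.Sum.Base using (_⊎_; inj₁; inj₂; [_,_]′)
open import Data.Unit.Base using (tt)
import Data.Vec.Base as Vec
open Vec using (Vec; []; _∷_; lookup; updateAt; _[_]≔_)
open import Data.Vec.Properties using (lookup-map)
open import Function.Base using (_∘_; id)
open import Induction.WellFounded using (Acc; acc)
open import Relation.Binary.Construct.Closure.Transitive using (TransClosure; [_]; _∷_)
open import Relation.Binary.PropositionalEquality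
  using (_≡_; _≢_; refl; sym; trans; cong; cong₂; subst; module ≡-Reasoning)
open import Relation.Nullary.Negation using (¬_)
open import Tactic.MonoidSolver using (solve)

-- Player ∃ is given no choice and all channels are visible, so a winning
-- strategy exists iff every infinite lossy run has even priority.  The channels
-- are the registers of a counter program together with a store of free tokens:
-- apart from an initial supply, each transition moves a token or none, so their
-- total number can only decrease, and it does so exactly at a loss.  The only odd
-- priority is that of the location restarting the program, which requires all
-- registers to be empty.  A run that restarts infinitely often is eventually
-- lossless, and then it contains an exact run of the program from the restarting
-- location back to it.
--
-- Given a Turing machine claimed to decide the problem, take a program that runs
-- the machine on the encoding of its own game and restarts iff the machine accepts.
-- The program gets hold of this encoding as follows.  It starts with N increments
-- of a register; N is the Gödel number of a template of the encoding in which
-- symbols stand for "1ᴺ", "the code of N increments" and "N priorities".  The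
-- template depends on the rest of the program but not on N, so N can be chosen last.

-- Counter programs: structured commands and flat instructions

Regs : ℕ → Set
Regs = Vec ℕ

infixr 5 _⨾_
data Cmd (k : ℕ) : Set where
  skip    : Cmd k
  inc dec : Fin k → Cmd k
  _⨾_     : Cmd k → Cmd k → Cmd k
  while   : Fin k → Cmd k → Cmd k
  if+     : Fin k → Cmd k → Cmd k → Cmd k

infix 4 _⊢_⇓_
data _⊢_⇓_ {k} : Cmd k → Regs k → Regs k → Set where
  skip : ∀ {v} → skip ⊢ v ⇓ v
  inc  : ∀ {r v} → inc r ⊢ v ⇓ updateAt v r suc
  dec  : ∀ {r v n} → lookup v r ≡ suc n → dec r ⊢ v ⇓ (v [ r ]≔ n)
  _⨾_  : ∀ {c d u v w} → c ⊢ u ⇓ v → d ⊢ v ⇓ w → c ⨾ d ⊢ u ⇓ w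
  done : ∀ {r c v} → lookup v r ≡ 0 → while r c ⊢ v ⇓ v
  loop : ∀ {r c u v w n} → lookup u r ≡ suc n → c ⊢ u ⇓ v → while r c ⊢ v ⇓ w →
         while r c ⊢ u ⇓ w
  if-pos  : ∀ {r c d v w n} → lookup v r ≡ suc n → c ⊢ v ⇓ w → if+ r c d ⊢ v ⇓ w
  if-zero : ∀ {r c d v w} → lookup v r ≡ 0 → d ⊢ v ⇓ w → if+ r c d ⊢ v ⇓ w

data Instr (k : ℕ) (A : Set) : Set where
  inc dec    : Fin k → A → Instr k A
  test       : Fin k → A → A → Instr k A
  jump reset : A → Instr k A

data Exec {k} {A : Set} : Instr k A → Regs k → A → Regs k → Set where
  inc   : ∀ {r a v} → Exec (inc r a) v a (updateAt v r suc)
  dec   : ∀ {r a v n} → lookup v r ≡ suc n → Exec (dec r a) v a (v [ r ]≔ n)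
  pos   : ∀ {r a b v n} → lookup v r ≡ suc n → Exec (test r a b) v a v
  zero  : ∀ {r a b v} → lookup v r ≡ 0 → Exec (test r a b) v b v
  jump  : ∀ {a v} → Exec (jump a) v a v
  -- `reset` clears nothing: it is executable only if all registers are already empty, and it blocks
  -- otherwise.
  reset : ∀ {a} → Exec (reset a) (Vec.replicate k 0) a (Vec.replicate k 0)

-- Determinism allows a single run that ends stuck to account for all runs from its start, as needed
-- in `run-terminates`.
Exec-deterministic : ∀ {k A} {i : Instr k A} {v a u b w} →
                     Exec i v a u → Exec i v b w → (a , u) ≡ (b , w)
Exec-deterministic inc      inc      = refl
Exec-deterministic (dec p)  (dec q)  rewrite suc-injective (trans (sym p) q) = refl
Exec-deterministic (pos p)  (pos q)  = refl
Exec-deterministic (pos p)  (zero q) with () ← trans (sym p) q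
Exec-deterministic (zero p) (pos q)  with () ← trans (sym p) q
Exec-deterministic (zero p) (zero q) = refl
Exec-deterministic jump     jump     = refl
Exec-deterministic reset    reset    = refl

-- Compilation

size : ∀ {k} → Cmd k → ℕ
size (c ⨾ d)     = size c + size d
size (while r c) = suc (size c)
size (if+ r c d) = suc (size c + size d)
size _           = 1

entry : ∀ {k} (c : Cmd k) → Fin (size c)
entry skip        = zero
entry (inc r)     = zero
entry (dec r)     = zero
entry (c ⨾ d)     = entry c ↑ˡ size d
entry (while r c) = zero
entry (if+ r c d) = zero

-- Control enters every block at its first location. Hence the jump targets into a block are known
-- in the encoding without knowing the block.
toℕ-entry : ∀ {k} (c : Cmd k) → toℕ (entry c) ≡ 0
toℕ-entry skip        = refl
toℕ-entry (inc r)     = refl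
toℕ-entry (dec r)     = refl
toℕ-entry (c ⨾ d)     = trans (toℕ-↑ˡ (entry c) (size d)) (toℕ-entry c)
toℕ-entry (while r c) = refl
toℕ-entry (if+ r c d) = refl

-- The instruction at each location of c, when these locations are named by ι
-- and control leaves c towards e.
code : ∀ {k} {A : Set} (c : Cmd k) → (Fin (size c) → A) → A → Fin (size c) → Instr k A
code skip        ι e zero    = jump e
code (inc r)     ι e zero    = inc r e
code (dec r)     ι e zero    = dec r e
code (c ⨾ d)     ι e i       =
  [ code c (λ j → ι (j ↑ˡ size d)) (ι (size c ↑ʳ entry d))
  , code d (λ j → ι (size c ↑ʳ j)) e ]′ (splitAt (size c) i)
code (while r c) ι e zero    = test r (ι (suc (entry c))) e
code (while r c) ι e (suc i) = code c (λ j → ι (suc j)) (ι zero) i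
code (if+ r c d) ι e zero    =
  test r (ι (suc (entry c ↑ˡ size d))) (ι (suc (size c ↑ʳ entry d)))
code (if+ r c d) ι e (suc i) =
  [ code c (λ j → ι (suc (j ↑ˡ size d))) e
  , code d (λ j → ι (suc (size c ↑ʳ j))) e ]′ (splitAt (size c) i)

mapInstr : ∀ {k} {A B : Set} → (A → B) → Instr k A → Instr k B
mapInstr f (inc r a)    = inc r (f a)
mapInstr f (dec r a)    = dec r (f a)
mapInstr f (test r a b) = test r (f a) (f b)
mapInstr f (jump a)     = jump (f a)
mapInstr f (reset a)    = reset (f a)

-- Compilation is natural in the addresses. This relates the code with locations in `Fin`, the code
-- with numerical addresses and the code with symbolic addresses of a template.
code-map : ∀ {k} {A B : Set} (h : A → B) (c : Cmd k) {ι ι′} {e e′} →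
           (∀ i → h (ι i) ≡ ι′ i) → h e ≡ e′ →
           ∀ i → mapInstr h (code c ι e i) ≡ code c ι′ e′ i
code-map h skip        p q zero    = cong jump q
code-map h (inc r)     p q zero    = cong (inc r) q
code-map h (dec r)     p q zero    = cong (dec r) q
code-map h (c ⨾ d)     p q i       with splitAt (size c) i
... | inj₁ j = code-map h c (λ _ → p _) (p _) j
... | inj₂ j = code-map h d (λ _ → p _) q j
code-map h (while r c) p q zero    = cong₂ (test r) (p _) q
code-map h (while r c) p q (suc i) = code-map h c (λ _ → p _) (p _) i
code-map h (if+ r c d) p q zero    = cong₂ (test r) (p _) (p _)
code-map h (if+ r c d) p q (suc i) with splitAt (size c) i
... | inj₁ j = code-map h c (λ _ → p _) q j
... | inj₂ j = code-map h d (λ _ → p _) q j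

-- Correctness of compilation

module _ {k : ℕ} {A : Set} (P : A → Instr k A) where

  infixr 5 _◅_ _◅◅_
  data Run : A → Regs k → A → Regs k → Set where
    ε   : ∀ {a v} → Run a v a v
    _◅_ : ∀ {a v b w c u} → Exec (P a) v b w → Run b w c u → Run a v c u

  _◅◅_ : ∀ {a v b w c u} → Run a v b w → Run b w c u → Run a v c u
  ε        ◅◅ q = q
  (x ◅ p) ◅◅ q = x ◅ (p ◅◅ q)

  private
    exec : ∀ {a v b w i} → P a ≡ i → Exec i v b w → Exec (P a) v b w
    exec refl x = x

    run1 : ∀ {a v b w i} → P a ≡ i → Exec i v b w → Run a v b w
    run1 p x = exec p x ◅ ε

  -- Induction on the evaluation. The hypothesis only asks that `P` contain the code of `c` at the
  -- addresses `ι`, so it passes to the blocks inside `c`.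
  code-run : ∀ (c : Cmd k) {ι e v w} → (∀ i → P (ι i) ≡ code c ι e i) →
             c ⊢ v ⇓ w → Run (ι (entry c)) v e w
  code-run skip    p skip    = run1 (p zero) jump
  code-run (inc r) p inc     = run1 (p zero) inc
  code-run (dec r) p (dec x) = run1 (p zero) (dec x)
  code-run (c ⨾ d) {ι} {e} p (x ⨾ y) = code-run c pc x ◅◅ code-run d pd y
    where
    pc : ∀ j → P (ι (j ↑ˡ size d)) ≡ code c _ (ι (size c ↑ʳ entry d)) j
    pc j = trans (p _) (cong [ _ , _ ]′ (splitAt-↑ˡ (size c) j (size d)))
    pd : ∀ j → P (ι (size c ↑ʳ j)) ≡ code d _ e j
    pd j = trans (p _) (cong [ _ , _ ]′ (splitAt-↑ʳ (size c) (size d) j))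
  code-run (while r c) p (done z)     = run1 (p zero) (zero z)
  code-run (while r c) p (loop z x y) =
    exec (p zero) (pos z) ◅ (code-run c (λ j → p (suc j)) x ◅◅ code-run (while r c) p y)
  code-run (if+ r c d) {ι} {e} p (if-pos z x) = exec (p zero) (pos z) ◅ code-run c pc x
    where
    pc : ∀ j → P (ι (suc (j ↑ˡ size d))) ≡ code c _ e j
    pc j = trans (p _) (cong [ _ , _ ]′ (splitAt-↑ˡ (size c) j (size d)))
  code-run (if+ r c d) {ι} {e} p (if-zero z x) = exec (p zero) (zero z) ◅ code-run d pd x
    where
    pd : ∀ j → P (ι (suc (size c ↑ʳ j))) ≡ code d _ e j
    pd j = trans (p _) (cong [ _ , _ ]′ (splitAt-↑ʳ (size c) (size d) j))

-- Runs within a budget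

-- The budget f is the number of free tokens: incrementing a register uses one.
Pay : ∀ {k} {A : Set} → Instr k A → ℕ → ℕ → Set
Pay (inc _ _) f f′ = f ≡ suc f′
Pay (dec _ _) f f′ = f′ ≡ suc f
Pay _         f f′ = f′ ≡ f

module _ {k : ℕ} {A : Set} (P : A → Instr k A) where

  Conf : Set
  Conf = A × Regs (suc k)

  infix 4 _⟶_
  data _⟶_ : Conf → Conf → Set where
    _,_ : ∀ {a f v b g w} → Pay (P a) f g → Exec (P a) v b w → (a , f ∷ v) ⟶ (b , g ∷ w)

  _⟶⁺_ : Conf → Conf → Set
  _⟶⁺_ = TransClosure _⟶_

  -- An increment takes a free token into a register and a decrement gives one back, so the total of
  -- free tokens and register contents is invariant.
  Pay-sum : ∀ (i : Instr k A) {f g v b w} → Pay i f g → Exec i v b w →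
            f + Vec.sum v ≡ g + Vec.sum w
  Pay-sum (inc r a) {g = g} {v} refl inc = trans (sym (+-suc g _)) (cong (g +_) (sym (lem v r)))
    where
    lem : ∀ {n} (v : Vec ℕ n) r → Vec.sum (updateAt v r suc) ≡ suc (Vec.sum v)
    lem (x ∷ v) zero    = refl
    lem (x ∷ v) (suc r) = trans (cong (x +_) (lem v r)) (+-suc x _)
  Pay-sum (dec r a) {f} {v = v} refl (dec p) = trans (cong (f +_) (lem v r p)) (+-suc f _)
    where
    lem : ∀ {n} (v : Vec ℕ n) r {x} → lookup v r ≡ suc x →
          Vec.sum v ≡ suc (Vec.sum (v [ r ]≔ x))
    lem (x ∷ v) zero    refl = refl
    lem (x ∷ v) (suc r) p    = trans (cong (x +_) (lem v r p)) (+-suc x _)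
  Pay-sum (test r a b) refl (pos _)  = refl
  Pay-sum (test r a b) refl (zero _) = refl
  Pay-sum (jump a)     refl jump     = refl
  Pay-sum (reset a)    refl reset    = refl

  ⟶-sum : ∀ {s t} → s ⟶ t → Vec.sum (proj₂ s) ≡ Vec.sum (proj₂ t)
  ⟶-sum (p , x) = Pay-sum (P _) p x

  steps : ∀ {a v b w} → Run P a v b w → ℕ
  steps ε       = 0
  steps (_ ◅ p) = suc (steps p)

  pay : ∀ (i : Instr k A) f → ∃[ g ] Pay i (suc f) g × f ≤ g
  pay (inc _ _)    f = f , refl , ≤-refl
  pay (dec _ _)    f = suc (suc f) , refl , m≤n+m f 2
  pay (test _ _ _) f = suc f , refl , n≤1+n f
  pay (jump _)     f = suc f , refl , n≤1+n f
  pay (reset _)    f = suc f , refl , n≤1+n f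

  -- One step uses at most one token, so a budget as large as the length of the run is enough.
  afford : ∀ {a v b w c u} (x : Exec (P a) v b w) (p : Run P b w c u) {f} → suc (steps p) ≤ f →
           ∃[ g ] (a , f ∷ v) ⟶⁺ (c , g ∷ u)
  afford {a} x ε {suc f} _ with g , q , _ ← pay (P a) f = g , [ q , x ]
  afford {a} x (y ◅ p) {suc f} (s≤s l)
    with g , q , f≤g ← pay (P a) f
    with h , ps ← afford y p (≤-trans l f≤g) = h , (q , x) ∷ ps

  ⟶⁺-sum : ∀ {s t} → s ⟶⁺ t → Vec.sum (proj₂ s) ≡ Vec.sum (proj₂ t)
  ⟶⁺-sum [ x ]   = ⟶-sum x
  ⟶⁺-sum (x ∷ p) = trans (⟶-sum x) (⟶⁺-sum p)

  Terminating : Conf → Set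
  Terminating = Acc (λ t s → s ⟶ t)

  -- By determinism, any step taken along the way must agree with the given run in location and
  -- registers. The budget may block a step but never offers an alternative, so accessibility
  -- follows by induction on the run, for every budget.
  run-terminates : ∀ {a v b w} → Run P a v b w → (∀ {c u} → ¬ Exec (P b) w c u) →
                   ∀ f → Terminating (a , f ∷ v)
  run-terminates ε       stuck f = acc λ { (_ , y) → ⊥-elim (stuck y) }
  run-terminates (_◅_ {b = b} {w} x p) stuck f = acc λ { (_ , y) → next (Exec-deterministic x y) _ }
    where
    next : ∀ {t} → (b , w) ≡ t → ∀ g → Terminating (proj₁ t , g ∷ proj₂ t)
    next refl g = run-terminates p stuck g

-- The game of a counter program

guards : ∀ {k} → Vec (Guard 1) k
guards = Vec.replicate _ any

zeros : ∀ {n} → Vec ℕ n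
zeros = Vec.replicate _ 0

nops : ∀ {k} → Vec (Op 1) k
nops = Vec.replicate _ nop

-- Channel 0 holds the free tokens and channel 1 + r the value of register r.
branches : ∀ {k} {A : Set} → Instr k A → List (Vec (Guard 1) (suc k) × Vec (Op 1) (suc k) × A)
branches (inc r b)    = (guards , recv zero ∷ (nops [ r ]≔ send zero) , b) ∷ []
branches (dec r b)    = (guards , send zero ∷ (nops [ r ]≔ recv zero) , b) ∷ []
branches (test r b c) = (any ∷ (guards [ r ]≔ starts zero) , nops , b) ∷
                        (any ∷ (guards [ r ]≔ empty) , nops , c) ∷ []
branches (jump b)     = (guards , nops , b) ∷ []
branches (reset b)    = (any ∷ Vec.replicate _ empty , nops , b) ∷ []

transitions : ∀ {k} {A : Set} {l} → (A → Fin l) → A → Instr k A → List (Transition (suc k) 1 1 l)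
transitions ι a i = map (λ (gr , op , b) → transition (ι a) zero gr op (ι b)) (branches i)

module _ {k : ℕ} (c : Cmd k) where

  -- Location 0 restarts the program; control comes back to it from the end of c.
  program : Fin (suc (size c)) → Instr k (Fin (suc (size c)))
  program zero    = reset (suc (entry c))
  program (suc i) = code c suc zero i

  -- Location 0 of the automaton supplies an arbitrary number of free tokens.
  supply : List (Transition (suc k) 1 1 (2 + size c))
  supply = transition zero zero guards (send zero ∷ nops) zero ∷
           transition zero zero guards nops (suc zero) ∷ []

  lcs : LCS
  lcs = record
    { channels = suc k ; messages = 1 ; labels₀ = 1 ; labels₁ = 0
    ; 𝒜₀ = record { locations = 2 + size c ; initial = zero
                  ; δ = supply ++ concatMap (λ a → transitions suc a (program a)) (allFin _) }
    ; 𝒜₁ = record { locations = 1 ; initial = zero ; δ = [] }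
    ; Σ∃ = ∅ }

  structure : GameStructure
  structure = record
    { lcs = lcs ; Cobs = ⊤ ; Cobs-guards = λ _ _ _ → ∈⊤ ; Cobs-reads = λ _ _ _ _ → ∈⊤ }

  -- Location `suc zero` of the automaton is location 0 of `program`, the restart. Its priority is
  -- the least one, so a play is odd as soon as it restarts infinitely often.
  priority : GameStructure.Obs structure → Fin 3
  priority (P₀ , suc zero , _) = suc zero
  priority _                   = suc (suc zero)

  game : ParityGame
  game = record { structure = structure ; maxPriority = 2 ; pr = priority }

  open ParityGame game hiding (lcs; structure)

  Channels : ℕ → Set
  Channels = Vec (List (Fin 1))

  -- With a single message, a channel content is determined by its length.
  counts : ∀ {n} → Channels n → Vec ℕ n
  counts = Vec.map length

  -- Transitions of the automaton are execution steps

  nops-sound : ∀ {n} (w w′ : Channels n) →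
               (∀ c → OpRelates (lookup nops c) (lookup w c) (lookup w′ c)) → w′ ≡ w
  nops-sound []      []        h = refl
  nops-sound (u ∷ w) (u′ ∷ w′) h = cong₂ _∷_ (h zero) (nops-sound w w′ (λ c → h (suc c)))

  length-∷ʳ : ∀ (u : List (Fin 1)) x → length (u ∷ʳ x) ≡ suc (length u)
  length-∷ʳ u x = trans (length-++ u) (+-comm (length u) 1)

  send-sound : ∀ {n} r (w w′ : Channels n) →
               (∀ c → OpRelates (lookup (nops [ r ]≔ send zero) c) (lookup w c) (lookup w′ c)) →
               counts w′ ≡ updateAt (counts w) r suc
  send-sound zero    (u ∷ w) (u′ ∷ w′) h =
    cong₂ _∷_ (trans (cong length (h zero)) (length-∷ʳ u zero))
              (cong counts (nops-sound w w′ (λ c → h (suc c))))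
  send-sound (suc r) (u ∷ w) (u′ ∷ w′) h =
    cong₂ _∷_ (cong length (h zero)) (send-sound r w w′ (λ c → h (suc c)))

  recv-sound : ∀ {n} r (w w′ : Channels n) →
               (∀ c → OpRelates (lookup (nops [ r ]≔ recv zero) c) (lookup w c) (lookup w′ c)) →
               ∃[ x ] lookup (counts w) r ≡ suc x × counts w′ ≡ (counts w [ r ]≔ x)
  recv-sound zero    (u ∷ w) (u′ ∷ w′) h =
    length u′ , cong length (sym (h zero)) ,
    cong (length u′ ∷_) (cong counts (nops-sound w w′ (λ c → h (suc c))))
  recv-sound (suc r) (u ∷ w) (u′ ∷ w′) h with x , p , q ← recv-sound r w w′ (λ c → h (suc c)) =
    x , p , cong₂ _∷_ (cong length (h zero)) q

  guard-sound : ∀ {n} r g (w : Channels n) →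
                (∀ c → GuardHolds (lookup (guards [ r ]≔ g) c) (lookup w c)) →
                GuardHolds g (lookup w r)
  guard-sound zero    g (u ∷ w) h = h zero
  guard-sound (suc r) g (u ∷ w) h = guard-sound r g w (λ c → h (suc c))

  empties-sound : ∀ {n} (w : Channels n) →
                  (∀ c → GuardHolds (lookup (Vec.replicate n empty) c) (lookup w c)) →
                  w ≡ Vec.replicate n []
  empties-sound []      h = refl
  empties-sound (u ∷ w) h = cong₂ _∷_ (h zero) (empties-sound w (λ c → h (suc c)))

  counts-empty : ∀ n → counts (Vec.replicate n []) ≡ Vec.replicate n 0
  counts-empty zero    = refl
  counts-empty (suc n) = cong (0 ∷_) (counts-empty n)

  transitions-sound :
    ∀ {A : Set} {l} {ι : A → Fin l} {a} i {q gr op q′ u u′} {w w′ : Channels k} →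
    transition q zero gr op q′ ∈ transitions ι a i →
    (∀ c → GuardHolds (lookup gr c) (lookup (u ∷ w) c) ×
           OpRelates (lookup op c) (lookup (u ∷ w) c) (lookup (u′ ∷ w′) c)) →
    q ≡ ι a × ∃[ b ] q′ ≡ ι b × Pay i (length u) (length u′) × Exec i (counts w) b (counts w′)
  transitions-sound (inc r b) {w = w} {w′} (here refl) h
    rewrite send-sound r w w′ (λ c → proj₂ (h (suc c))) =
    refl , b , refl , sym (cong length (proj₂ (h zero))) , inc
  transitions-sound (dec r b) {u = u} {w = w} {w′} (here refl) h
    with x , p , q ← recv-sound r w w′ (λ c → proj₂ (h (suc c))) rewrite q =
    refl , b , refl , trans (cong length (proj₂ (h zero))) (length-∷ʳ u zero) , dec p
  transitions-sound (test r b d) {w = w} {w′} (here refl) h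
    rewrite nops-sound w w′ (λ c → proj₂ (h (suc c)))
    with v , p ← guard-sound r (starts zero) w (λ c → proj₁ (h (suc c))) =
    refl , b , refl , cong length (proj₂ (h zero)) , pos (trans (lookup-map r length w) (cong length p))
  transitions-sound (test r b d) {w = w} {w′} (there (here refl)) h
    rewrite nops-sound w w′ (λ c → proj₂ (h (suc c))) =
    refl , d , refl , cong length (proj₂ (h zero)) ,
    zero (trans (lookup-map r length w) (cong length (guard-sound r empty w (λ c → proj₁ (h (suc c))))))
  transitions-sound (jump b) {w = w} {w′} (here refl) h
    rewrite nops-sound w w′ (λ c → proj₂ (h (suc c))) =
    refl , b , refl , cong length (proj₂ (h zero)) , jump
  transitions-sound (reset b) {w = w} {w′} (here refl) h
    rewrite nops-sound w w′ (λ c → proj₂ (h (suc c)))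
          | empties-sound w (λ c → proj₁ (h (suc c))) | counts-empty k =
    refl , b , refl , cong length (proj₂ (h zero)) , reset

  infix 4 _⟶ₑ_
  _⟶ₑ_ : Conf program → Conf program → Set
  _⟶ₑ_ = _⟶_ program

  strong-sound : ∀ a w q′ w′ → Fires 𝒜₀.δ (suc a) w zero q′ w′ →
                 ∃[ b ] q′ ≡ suc b × (a , counts w) ⟶ₑ (b , counts w′)
  strong-sound a (u ∷ w) q′ (u′ ∷ w′) (gr , op , t∈ , h) with ∈-++⁻ supply t∈
  -- Both supply transitions leave location 0 of the automaton, which is not of the form `suc a`.
  ... | inj₁ (here ())
  ... | inj₁ (there (here ()))
  ... | inj₁ (there (there ()))
  ... | inj₂ t∈′ = go (Any.satisfied
      (∈-concatMap⁻ (λ a → transitions suc a (program a)) {xs = allFin _} t∈′))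
    where
    go : (∃[ a′ ] transition (suc a) zero gr op q′ ∈ transitions suc a′ (program a′)) →
         ∃[ b ] q′ ≡ suc b × (a , counts (u ∷ w)) ⟶ₑ (b , counts (u′ ∷ w′))
    go (a′ , t∈) with refl , b , p , q , x ← transitions-sound (program a′) t∈ h = b , p , (q , x)

  -- A subword is at most as long as the word. So either no length changes, and the loss is void, or
  -- the total drops.
  loss : ∀ {n} (w w′ : Channels n) → (∀ c → lookup w c ⊆ lookup w′ c) →
         counts w ≡ counts w′ ⊎ Vec.sum (counts w) < Vec.sum (counts w′)
  loss []      []        h = inj₁ refl
  loss (u ∷ w) (u′ ∷ w′) h
    with m≤n⇒m<n∨m≡n (length-mono-≤ (h zero)) | loss w w′ (λ c → h (suc c))
  ... | inj₁ lt | inj₁ eq  rewrite eq = inj₂ (+-monoˡ-< _ lt)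
  ... | inj₁ lt | inj₂ lt′ = inj₂ (+-mono-< lt lt′)
  ... | inj₂ eq | inj₁ eq′ = inj₁ (cong₂ _∷_ eq eq′)
  ... | inj₂ eq | inj₂ lt  rewrite eq = inj₂ (+-monoʳ-< (length u′) lt)

  -- Messages may be lost before and after the strong transition, which itself preserves the total.
  -- The step is exact if nothing is lost on either side; any loss makes the total drop strictly.
  weak-sound : ∀ a q₁ w q′ q₁′ w′ → Weak (suc a , q₁ , w) (inj₁ zero) (q′ , q₁′ , w′) →
               ∃[ b ] q′ ≡ suc b ×
               ((a , counts w) ⟶ₑ (b , counts w′) ⊎ Vec.sum (counts w′) < Vec.sum (counts w))
  weak-sound a _ w _ _ w′ (w₁ , w₂ , w₁≼w , w′≼w₂ , _ , fires)
    with b , refl , x ← strong-sound a w₁ _ w₂ fires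
    with loss w₁ w w₁≼w | loss w′ w₂ w′≼w₂
  ... | inj₁ p | inj₁ q rewrite p | q = b , refl , inj₁ x
  ... | inj₁ p | inj₂ q rewrite sym p =
    b , refl , inj₂ (<-≤-trans q (≤-reflexive (sym (⟶-sum program x))))
  ... | inj₂ p | inj₁ q rewrite q = b , refl , inj₂ (≤-<-trans (≤-reflexive (sym (⟶-sum program x))) p)
  ... | inj₂ p | inj₂ q =
    b , refl , inj₂ (<-trans (<-≤-trans q (≤-reflexive (sym (⟶-sum program x)))) p)

  loss-empty : ∀ {n} (w w′ : Channels n) → (∀ c → lookup w c ⊆ lookup w′ c) →
               counts w′ ≡ zeros → counts w ≡ zeros
  loss-empty []      []        h p = refl
  loss-empty (u ∷ w) ([] ∷ w′) h p =
    cong₂ _∷_ (n≤0⇒n≡0 (length-mono-≤ (h zero))) (loss-empty w w′ (λ c → h (suc c)) (cong Vec.tail p))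

  reset-exec : ∀ {A : Set} {a b : A} {v v′ : Regs k} → Exec (reset a) v b v′ → b ≡ a × v′ ≡ zeros
  reset-exec reset = refl , refl

  -- Even a lossy restart begins a fresh run: whatever was lost before the test, the registers pass
  -- it empty, and losses afterwards cannot fill them. Only the number of free tokens is left open.
  reset-sound : ∀ q₁ w q′ q₁′ w′ → Weak (suc zero , q₁ , w) (inj₁ zero) (q′ , q₁′ , w′) →
                q′ ≡ suc (suc (entry c)) × ∃[ f ] counts w′ ≡ f ∷ zeros
  reset-sound _ _ _ _ (u′ ∷ w′) (u₁ ∷ w₁ , u₂ ∷ w₂ , w₁≼w , w′≼w₂ , _ , fires)
    with b , refl , (_ , x) ← strong-sound zero (u₁ ∷ w₁) _ (u₂ ∷ w₂) fires
    with refl , p ← reset-exec x =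
    refl , length u′ , cong (length u′ ∷_) (loss-empty w′ w₂ (λ c → w′≼w₂ (suc c)) p)
  -- Plays that restart infinitely often

  -- The second automaton has no labels, and a label of the first one cannot be used in a turn of
  -- `P₁`.
  P₁-stuck : ∀ s a∃ a t → ¬ Move (P₁ , s) a∃ a t
  P₁-stuck s a∃ (inj₁ _) t (_ , () , _)

  move-weak : ∀ s a∃ a p t → Move (P₀ , s) a∃ a (p , t) → Weak s (inj₁ zero) t
  move-weak s a∃ (inj₁ zero) p t (_ , _ , m) = m

  module _ (ρ : InfSeq) (play : IsPlay (inj₂ ρ)) where

    At : ℕ → Conf program → Set
    At i (a , v) = ∃[ q₁ ] ∃[ w ] state ρ i ≡ (P₀ , suc a , q₁ , w) × counts w ≡ v

    play-move : ∀ i {s} → state ρ i ≡ (P₀ , s) →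
           ∃[ s′ ] state ρ (suc i) ≡ (P₀ , s′) × Weak s (inj₁ zero) s′
    play-move i {s} p
      with state ρ (suc i) in eq
         | subst (λ t → Move t (choice ρ i) (label ρ i) (state ρ (suc i))) p (proj₂ play i)
    ... | P₀ , s′ | m = s′ , refl , move-weak s (choice ρ i) (label ρ i) P₀ s′ m
    -- The rules let any player be next, but a turn of `P₁` would be the end of the play.
    ... | P₁ , s′ | m = ⊥-elim (P₁-stuck s′ a∃ a t (subst (λ s → Move s a∃ a t) eq (proj₂ play (suc i))))
      where
      a∃ : Choice
      a∃ = choice ρ (suc i)
      a : Label
      a = label ρ (suc i)
      t : State
      t = state ρ (suc (suc i))

    play-step : ∀ {i s} → At i s → ∃[ t ] At (suc i) t × (s ⟶ₑ t ⊎ Vec.sum (proj₂ t) < Vec.sum (proj₂ s))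
    play-step {i} (q₁ , w , p , refl)
      with (_ , q₁′ , w′) , p′ , m ← play-move i p
      with b , refl , x ← weak-sound _ q₁ w _ q₁′ w′ m = (b , counts w′) , (q₁′ , w′ , p′ , refl) , x

    play-step-≤ : ∀ {i s} → At i s → ∃[ t ] At (suc i) t × Vec.sum (proj₂ t) ≤ Vec.sum (proj₂ s)
    play-step-≤ h with play-step h
    ... | t , h′ , inj₁ x  = t , h′ , ≤-reflexive (sym (⟶-sum program x))
    ... | t , h′ , inj₂ lt = t , h′ , <⇒≤ lt

    later : ∀ {i s} j → At i s → ∃[ t ] At (j + i) t × Vec.sum (proj₂ t) ≤ Vec.sum (proj₂ s)
    later zero    h = _ , h , ≤-refl
    later (suc j) h with t , h′ , l ← later j h with u , h″ , l′ ← play-step-≤ h′ = u , h″ , ≤-trans l′ l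

    module _ (restarts : ∀ n → ∃[ i ] n ≤ i × ∃[ v ] At i (zero , v))
             (terminates : ∀ f → Terminating program (suc (entry c) , f ∷ zeros)) where

      -- The play is followed to its next restart and one step beyond. The total never grows on the
      -- way, and `reset-sound` gives the form of the configuration reached.
      restart : ∀ {i s} → At i s → ∃[ j ] ∃[ f ] At j (suc (entry c) , f ∷ zeros) ×
                Vec.sum (f ∷ zeros {k}) ≤ Vec.sum (proj₂ s)
      restart {i} {s} h
        with j , i≤j , v , at ← restarts i
        with (_ , _) , (_ , w , p , refl) , l ←
          subst (λ j → ∃[ t ] At j t × Vec.sum (proj₂ t) ≤ Vec.sum (proj₂ s))
                (m∸n+n≡m i≤j) (later (j ∸ i) h)
        with _ , _ , p′ , refl ← at
        -- `later` and `restarts` describe the same state at position `j`. The successor state is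
        -- identified in the same way below.
        with refl ← trans (sym p) p′
        with _ , at′ , l′ ← play-step-≤ at
        with (_ , q₁′ , w′) , e , m ← play-move j p
        with refl , f , q ← reset-sound _ w _ q₁′ w′ m
        with _ , _ , e′ , refl ← at′
        with refl ← trans (sym e) e′ =
        suc j , f , (_ , _ , e , q) , subst (λ v → Vec.sum v ≤ Vec.sum (proj₂ s)) q (≤-trans l′ l)

      -- Outer induction on a bound for the total, inner induction on the termination of the exact
      -- run begun at a restart. Each exact step descends in the inner induction; a loss lowers the
      -- total and returns to the outer one. As the play never ends, one of the two always happens,
      -- which is absurd.
      finitely-many-restarts : ∀ {n} → Acc _<_ n → ∀ {i s} → At i s → Vec.sum (proj₂ s) ≤ n → ⊥
      finitely-many-restarts {n} (acc rec) h l
        with _ , f , h′ , l′ ← restart h = exact (terminates f) h′ (≤-trans l′ l)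
        where
        exact : ∀ {i s} → Terminating program s → At i s → Vec.sum (proj₂ s) ≤ n → ⊥
        exact (acc rec′) h l with play-step h
        ... | t , h′ , inj₁ x  = exact (rec′ x) h′ (≤-trans (≤-reflexive (sym (⟶-sum program x))) l)
        ... | t , h′ , inj₂ lt = finitely-many-restarts (rec (<-≤-trans lt l)) h′ ≤-refl

  observed-restart : ∀ s {h} → obs s ≡ (P₀ , suc zero , h) → ∃[ q₁ ] ∃[ w ] s ≡ (P₀ , suc zero , q₁ , w)
  observed-restart (P₀ , _ , q₁ , w) refl = q₁ , w , refl

  strategy : Strategy
  strategy = record
    { choose  = λ _ _ → nothing
    ; allowed = λ _ _ → inj₁ λ (_ , _ , a∈∅) → ∉⊥ a∈∅ }

  terminating⇒winning : (∀ f → Terminating program (suc (entry c) , f ∷ zeros)) →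
                        HasConsistentWinningStrategy game
  terminating⇒winning terminates = strategy , (λ _ _ _ _ _ → refl) , winning
    where
    visits : ∀ ρ {h} → InfObs ρ (P₀ , suc zero , h) → IsPlay (inj₂ ρ) → 2 ∣ 1
    visits ρ inf play =
      ⊥-elim (finitely-many-restarts ρ play restarts terminates (<-wellFounded _)
                (proj₂ (proj₂ (proj₂ (restarts 0)))) ≤-refl)
      where
      restarts : ∀ n → ∃[ i ] n ≤ i × ∃[ v ] At ρ play i (zero , v)
      restarts n with i , n≤i , p ← inf n with q₁ , w , eq ← observed-restart (state ρ i) p =
        i , n≤i , counts w , q₁ , w , eq , refl

    winning : Winning strategy
    -- The priority of the play is that of some observation seen infinitely often, and only the
    -- restart has an odd one.
    winning ρ (play , _) k (((P₀ , zero , _) , inf , refl) , _)        = divides 1 refl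
    winning ρ (play , _) k (((P₀ , suc zero , _) , inf , refl) , _)    = visits ρ inf play
    winning ρ (play , _) k (((P₀ , suc (suc _) , _) , inf , refl) , _) = divides 1 refl
    winning ρ (play , _) k (((P₁ , _ , _) , inf , refl) , _)           = divides 1 refl

  -- Execution steps are transitions of the automaton

  unary : ∀ {n} → Vec ℕ n → Channels n
  unary = Vec.map (λ x → replicate x zero)

  ∷ʳ-replicate : ∀ n → replicate {A = Fin 1} (suc n) zero ≡ replicate n zero ∷ʳ zero
  ∷ʳ-replicate zero    = refl
  ∷ʳ-replicate (suc n) = cong (zero ∷_) (∷ʳ-replicate n)

  nops-complete : ∀ {n} (v : Vec ℕ n) c → OpRelates (lookup nops c) (lookup (unary v) c) (lookup (unary v) c)
  nops-complete (x ∷ v) zero    = refl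
  nops-complete (x ∷ v) (suc c) = nops-complete v c

  send-complete : ∀ {n} r (v : Vec ℕ n) c →
    OpRelates (lookup (nops [ r ]≔ send zero) c) (lookup (unary v) c) (lookup (unary (updateAt v r suc)) c)
  send-complete zero    (x ∷ v) zero    = ∷ʳ-replicate x
  send-complete zero    (x ∷ v) (suc c) = nops-complete v c
  send-complete (suc r) (x ∷ v) zero    = refl
  send-complete (suc r) (x ∷ v) (suc c) = send-complete r v c

  recv-complete : ∀ {n} r (v : Vec ℕ n) {x} → lookup v r ≡ suc x → ∀ c →
    OpRelates (lookup (nops [ r ]≔ recv zero) c) (lookup (unary v) c) (lookup (unary (v [ r ]≔ x)) c)
  recv-complete zero    (x ∷ v) refl zero    = refl
  recv-complete zero    (x ∷ v) p    (suc c) = nops-complete v c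
  recv-complete (suc r) (x ∷ v) p    zero    = refl
  recv-complete (suc r) (x ∷ v) p    (suc c) = recv-complete r v p c

  guards-complete : ∀ {n} (w : Channels n) c → GuardHolds (lookup guards c) (lookup w c)
  guards-complete (u ∷ w) zero    = tt
  guards-complete (u ∷ w) (suc c) = guards-complete w c

  guard-complete : ∀ {n} r g (w : Channels n) → GuardHolds g (lookup w r) →
                   ∀ c → GuardHolds (lookup (guards [ r ]≔ g) c) (lookup w c)
  guard-complete zero    g (u ∷ w) h zero    = h
  guard-complete zero    g (u ∷ w) h (suc c) = guards-complete w c
  guard-complete (suc r) g (u ∷ w) h zero    = tt
  guard-complete (suc r) g (u ∷ w) h (suc c) = guard-complete r g w h c

  empties-complete : ∀ {n} c → GuardHolds (lookup (Vec.replicate n empty) c) (lookup (unary (zeros {n})) c)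
  empties-complete zero    = refl
  empties-complete (suc c) = empties-complete c

  lookup-unary : ∀ {n} (v : Vec ℕ n) r {x} → lookup v r ≡ x → lookup (unary v) r ≡ replicate x zero
  lookup-unary v r refl = lookup-map r _ v

  transitions-complete :
    ∀ {A : Set} {l} {ι : A → Fin l} {a} (i : Instr k A) {f g v b v′} → Pay i f g → Exec i v b v′ →
    ∃[ gr ] ∃[ op ] transition (ι a) zero gr op (ι b) ∈ transitions ι a i ×
      (∀ c → GuardHolds (lookup gr c) (lookup (unary (f ∷ v)) c) ×
             OpRelates (lookup op c) (lookup (unary (f ∷ v)) c) (lookup (unary (g ∷ v′)) c))
  transitions-complete (inc r b) {v = v} refl inc =
    _ , _ , here refl , ∀-cons (tt , refl) λ c → guards-complete (unary v) c , send-complete r v c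
  transitions-complete (dec r b) {f} {v = v} refl (dec p) =
    _ , _ , here refl , ∀-cons (tt , ∷ʳ-replicate f) λ c → guards-complete (unary v) c , recv-complete r v p c
  transitions-complete (test r b d) {v = v} refl (pos {n = x} p) =
    _ , _ , here refl , ∀-cons (tt , refl) λ c →
    guard-complete r (starts zero) (unary v) (replicate x zero , lookup-unary v r p) c , nops-complete v c
  transitions-complete (test r b d) {v = v} refl (zero p) =
    _ , _ , there (here refl) , ∀-cons (tt , refl) λ c →
    guard-complete r empty (unary v) (lookup-unary v r p) c , nops-complete v c
  transitions-complete (jump b) {v = v} refl jump =
    _ , _ , here refl , ∀-cons (tt , refl) λ c → guards-complete (unary v) c , nops-complete v c
  transitions-complete (reset b) refl reset =
    _ , _ , here refl , ∀-cons (tt , refl) λ c → empties-complete c , nops-complete zeros c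

  strong-complete : ∀ {a v b v′} → (a , v) ⟶ₑ (b , v′) → Fires 𝒜₀.δ (suc a) (unary v) zero (suc b) (unary v′)
  strong-complete {a} (q , x)
    with gr , op , t∈ , h ← transitions-complete {ι = suc} {a} (program a) q x =
    gr , op ,
    ∈-++⁺ʳ supply (∈-concatMap⁺ (λ a → transitions suc a (program a))
                    (Any.map (λ { refl → t∈ }) (∈-allFin a))) , h

  -- Lossless plays that repeat a run forever

  _⇒_ : State → State → Set
  s ⇒ t = Move s nothing (inj₁ zero) t

  at : Fin (2 + size c) → Vec ℕ (suc k) → State
  at q v = P₀ , q , zero , unary v

  fires⇒move : ∀ q v q′ v′ → Fires 𝒜₀.δ q (unary v) zero q′ (unary v′) → at q v ⇒ at q′ v′
  fires⇒move q v q′ v′ fires =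
    (inj₁ (λ (_ , _ , a∈∅) → ∉⊥ a∈∅) , inj₂ ((at q v , refl , refl , at q′ v′ , refl , refl , fires) , ∉⊥)) ,
    refl , unary v , unary v′ , (λ _ → ⊆-refl) , (λ _ → ⊆-refl) , refl , fires

  conf : Conf program → State
  conf (a , v) = at (suc a) v

  step⇒move : ∀ {s t} → s ⟶ₑ t → conf s ⇒ conf t
  step⇒move {a , v} {b , w} x = fires⇒move (suc a) v (suc b) w (strong-complete x)

  path : ∀ {s t} → _⟶⁺_ program s t → TransClosure _⇒_ (conf s) (conf t)
  path [ x ]             = [ step⇒move x ]
  path (_∷_ {y = t} x p) = _∷_ {y = conf t} (step⇒move x) (path p)

  supply-path : ∀ m n → TransClosure _⇒_ (at zero (n ∷ zeros)) (at (suc zero) (m + n ∷ zeros))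
  supply-path zero    n =
    [ fires⇒move zero (n ∷ zeros) (suc zero) (n ∷ zeros)
        (_ , _ , ∈-++⁺ˡ {xs = supply} (there (here refl)) , ∀-cons (tt , refl) λ c →
                  guards-complete (unary (zeros {k})) c , nops-complete (zeros {k}) c) ]
  supply-path (suc m) n =
    fires⇒move zero (n ∷ zeros) zero (suc n ∷ zeros)
      (_ , _ , ∈-++⁺ˡ {xs = supply} (here refl) , ∀-cons (tt , ∷ʳ-replicate n) λ c →
                guards-complete (unary (zeros {k})) c , nops-complete (zeros {k}) c)
    ∷ subst (λ x → TransClosure _⇒_ (at zero (suc n ∷ zeros)) (at (suc zero) (x ∷ zeros)))
            (+-suc m n) (supply-path m (suc n))

  module Lasso {s r : State} (stem : TransClosure _⇒_ s r) (cycle : TransClosure _⇒_ r r) where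

    -- A state of the lasso together with the path that remains until `r`; on arrival at `r` the
    -- remaining path becomes `cycle`.
    Node : Set
    Node = ∃[ s ] TransClosure _⇒_ s r

    advance : Node → Node
    advance (s , [ x ])   = r , cycle
    advance (s , x ∷ p) = _ , p

    node : ℕ → Node
    node zero    = s , stem
    node (suc n) = advance (node n)

    advance-move : ∀ n → proj₁ n ⇒ proj₁ (advance n)
    advance-move (s , [ x ])   = x
    advance-move (s , x ∷ p) = x

    reaches : ∀ {s} (p : TransClosure _⇒_ s r) i → node i ≡ (s , p) → ∃[ j ] i ≤ j × proj₁ (node j) ≡ r
    reaches [ x ]   i e = suc i , n≤1+n i , cong (proj₁ ∘ advance) e
    reaches (x ∷ p) i e with j , l , q ← reaches p (suc i) (cong advance e) = j , <⇒≤ l , q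

    lasso : InfSeq
    lasso = record { state = λ i → proj₁ (node i) ; choice = λ _ → nothing ; label = λ _ → inj₁ zero }

    recurs : ∀ i → ∃[ j ] i ≤ j × state lasso j ≡ r
    recurs i = reaches _ i refl

  zeros-unary : ∀ {n} → unary (zeros {n}) ≡ Vec.replicate n []
  zeros-unary {zero}  = refl
  zeros-unary {suc n} = cong ([] ∷_) zeros-unary

  choice-⊥ : ∀ {o a} → Act∃ o a → a ≡ nothing
  choice-⊥ {a = nothing} _         = refl
  choice-⊥ {a = just a}  (_ , a∈∅) = ⊥-elim (∉⊥ a∈∅)

  odd-visible : ∀ o → 1 ≤ toℕ (priority o)
  odd-visible (P₀ , zero , _)        = s≤s z≤n
  odd-visible (P₀ , suc zero , _)    = s≤s z≤n
  odd-visible (P₀ , suc (suc _) , _) = s≤s z≤n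
  odd-visible (P₁ , _)               = s≤s z≤n

  -- The choice is always `nothing`, so every play follows every strategy, and a single infinite
  -- play of priority 1 refutes them all: supply enough tokens, then repeat the exact run without
  -- loss.
  cycle⇒¬winning : Run program (suc (entry c)) zeros zero zeros → ¬ HasConsistentWinningStrategy game
  cycle⇒¬winning run (f , _ , winning) = absurd (∣1⇒≡1 (winning lasso (play , follows) 1 odd))
    where
    absurd : 2 ≢ 1
    absurd ()
    budget : ℕ
    -- One token for each step of `run` and one for the `reset` before it.
    budget = suc (steps program run)
    cycle : _⟶⁺_ program (zero , budget ∷ zeros) (zero , budget ∷ zeros)
    -- The registers are empty at both ends, so invariance of the total forces the final budget to
    -- equal the initial one.
    cycle with g , p ← afford program reset run {budget} ≤-refl =
      subst (λ x → _⟶⁺_ program (zero , budget ∷ zeros) (zero , x ∷ zeros))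
            (sym (+-cancelʳ-≡ _ _ _ (⟶⁺-sum program p))) p
    stem : TransClosure _⇒_ (at zero (0 ∷ zeros)) (at (suc zero) (budget ∷ zeros))
    stem = subst (λ x → TransClosure _⇒_ (at zero (0 ∷ zeros)) (at (suc zero) (x ∷ zeros)))
                 (+-identityʳ budget) (supply-path budget 0)
    open Lasso stem (path cycle)
    play : IsPlay (inj₂ lasso)
    play = cong (λ w → zero , zero , [] ∷ w) zeros-unary , λ i → advance-move (node i)
    follows : ∀ π a∃ a s → (π · a∃ · a · s) ⊑ inj₂ lasso → (p : Prefs∃ π) → a∃ ≡ choose f π p
    follows π a∃ a s (suc n , refl) p = sym (choice-⊥ (allowed f π p))
    odd : HasPriority lasso 1
    odd = (_ , (λ n → let j , l , e = recurs n in j , l , cong obs e) , refl) , λ o _ → odd-visible o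

-- The encoding of the game

private variable
  A B : Set
  k   : ℕ

bits : List ℕ → List Bool
bits = concatMap (λ n → replicate n true ∷ʳ false)

bits-++ : ∀ xs ys → bits (xs ++ ys) ≡ bits xs ++ bits ys
bits-++ = concatMap-++ (λ n → replicate n true ∷ʳ false)

-- Numbers in a template: shifted a is location a after the N increments, which occupy
-- the locations 2, …, N + 1.
data Atom : Set where
  fixed shifted : ℕ → Atom

value : ℕ → Atom → ℕ
value N (fixed a)   = a
value N (shifted a) = 2 + N + a

-- The leading 1 is the mark of a further entry in `encodeList`; the 0 is the only label.
transitionAtoms : Atom → Vec (Guard 1) k → Vec (Op 1) k → Atom → List Atom
transitionAtoms s gr op t =
  fixed 1 ∷ s ∷ fixed 0 ∷ map fixed (encodeVec encodeGuard gr) ++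
  map fixed (encodeVec encodeOp op) ++ t ∷ []

transitionNumbers : ℕ → Vec (Guard 1) k → Vec (Op 1) k → ℕ → List ℕ
transitionNumbers s gr op t =
  1 ∷ s ∷ 0 ∷ encodeVec encodeGuard gr ++ encodeVec encodeOp op ++ t ∷ []

atoms : Atom → Instr k Atom → List Atom
atoms s i = concatMap (λ (gr , op , t) → transitionAtoms s gr op t) (branches i)

numbers : ℕ → Instr k ℕ → List ℕ
numbers s i = concatMap (λ (gr , op , t) → transitionNumbers s gr op t) (branches i)

-- `encodeList` without its end mark, and therefore compatible with concatenation.
encodeItems : (A → List ℕ) → List A → List ℕ
encodeItems f = concatMap (λ x → 1 ∷ f x)

encodeList-items : (f : A → List ℕ) (xs : List A) → encodeList f xs ≡ encodeItems f xs ++ 0 ∷ []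
encodeList-items f []       = refl
encodeList-items f (x ∷ xs) =
  cong (1 ∷_) (trans (cong (f x ++_) (encodeList-items f xs)) (sym (++-assoc (f x) _ _)))

encode-transitions : ∀ {l} (ι : A → Fin l) a (i : Instr k A) →
  encodeItems encodeTransition (transitions ι a i) ≡ numbers (toℕ (ι a)) (mapInstr (toℕ ∘ ι) i)
encode-transitions ι a (inc r b)    = refl
encode-transitions ι a (dec r b)    = refl
encode-transitions ι a (test r b c) = refl
encode-transitions ι a (jump b)     = refl
encode-transitions ι a (reset b)    = refl

map-value-fixed : ∀ N xs → map (value N) (map fixed xs) ≡ xs
map-value-fixed N xs = trans (sym (map-∘ xs)) (map-id xs)

value-transition : ∀ N s (gr : Vec (Guard 1) k) (op : Vec (Op 1) k) t →
  map (value N) (transitionAtoms s gr op t) ≡ transitionNumbers (value N s) gr op (value N t)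
value-transition N s gr op t = cong (λ xs → 1 ∷ value N s ∷ 0 ∷ xs)
  (trans (map-++ (value N) (map fixed (encodeVec encodeGuard gr)) _)
  (cong₂ _++_ (map-value-fixed N (encodeVec encodeGuard gr))
  (trans (map-++ (value N) (map fixed (encodeVec encodeOp op)) _)
  (cong (_++ value N t ∷ []) (map-value-fixed N (encodeVec encodeOp op))))))

value-branches : ∀ N s (bs : List (Vec (Guard 1) (suc k) × Vec (Op 1) (suc k) × Atom)) →
  map (value N) (concatMap (λ (gr , op , t) → transitionAtoms s gr op t) bs) ≡
  concatMap (λ (gr , op , t) → transitionNumbers (value N s) gr op (value N t)) bs
value-branches N s []                   = refl
value-branches N s ((gr , op , t) ∷ bs) =
  trans (map-++ (value N) (transitionAtoms s gr op t) _)
        (cong₂ _++_ (value-transition N s gr op t) (value-branches N s bs))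

value-atoms : ∀ N s (i : Instr k Atom) →
  map (value N) (atoms s i) ≡ numbers (value N s) (mapInstr (value N) i)
value-atoms N s i = trans (value-branches N s (branches i)) (mapped i)
  where
  mapped : (i : Instr _ Atom) →
    concatMap (λ (gr , op , t) → transitionNumbers (value N s) gr op (value N t)) (branches i) ≡
    numbers (value N s) (mapInstr (value N) i)
  mapped (inc r b)    = refl
  mapped (dec r b)    = refl
  mapped (test r b c) = refl
  mapped (jump b)     = refl
  mapped (reset b)    = refl

-- Here `b` is the address of the first location of `c` and `e` the address to which `c` exits.
commandNumbers : Cmd k → ℕ → ℕ → List ℕ
commandNumbers c b e =
  concatMap (λ j → numbers (b + toℕ j) (code c (λ j → b + toℕ j) e j)) (allFin (size c))

concatMap-allFin : ∀ n (f : Fin (suc n) → List B) →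
                   concatMap f (allFin (suc n)) ≡ f zero ++ concatMap (f ∘ suc) (allFin n)
concatMap-allFin n f = cong (f zero ++_)
  (trans (cong (concatMap f) (sym (map-tabulate id suc))) (concatMap-map f suc (allFin n)))

concatMap-concatMap : ∀ {C : Set} (g : B → List C) (f : A → List B) xs →
                      concatMap g (concatMap f xs) ≡ concatMap (concatMap g ∘ f) xs
concatMap-concatMap g f []       = refl
concatMap-concatMap g f (x ∷ xs) =
  trans (concatMap-++ g (f x) (concatMap f xs))
        (cong (concatMap g (f x) ++_) (concatMap-concatMap g f xs))

-- Address 0 is the supply and address 1 the restart, so the command starts at address 2 and exits
-- to 1.
encode-δ : (c : Cmd k) →
  encodeItems encodeTransition (concatMap (λ a → transitions suc a (program c a)) (allFin _)) ≡
  numbers 1 (reset {k} 2) ++ commandNumbers c 2 1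
encode-δ {k} c = begin
  encodeItems encodeTransition (concatMap (λ a → transitions suc a (program c a)) (allFin _))
    ≡⟨ concatMap-concatMap (λ x → 1 ∷ encodeTransition x)
                           (λ a → transitions suc a (program c a)) (allFin _) ⟩
  concatMap (λ a → encodeItems encodeTransition (transitions suc a (program c a))) (allFin _)
    ≡⟨ concatMap-cong (λ a → encode-transitions suc a (program c a)) (allFin _) ⟩
  concatMap (λ a → numbers (suc (toℕ a)) (mapInstr (suc ∘ toℕ) (program c a))) (allFin _)
    ≡⟨ concatMap-allFin _ (λ a → numbers (suc (toℕ a)) (mapInstr (suc ∘ toℕ) (program c a))) ⟩
  numbers 1 (reset {k} (2 + toℕ (entry c))) ++
  concatMap (λ j → numbers (2 + toℕ j) (mapInstr (suc ∘ toℕ) (code c suc zero j))) (allFin _)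
    ≡⟨ cong₂ (λ x y → numbers 1 (reset {k} (2 + x)) ++ y) (toℕ-entry c)
        (concatMap-cong (λ j → cong (numbers (2 + toℕ j)) (code-map (suc ∘ toℕ) c (λ _ → refl) refl j))
                        (allFin _)) ⟩
  numbers 1 (reset {k} 2) ++ commandNumbers c 2 1 ∎
  where open ≡-Reasoning

-- The chain of initial increments

incs : Fin k → ℕ → Cmd k → Cmd k
incs d zero    c = c
incs d (suc n) c = incs d n (inc d ⨾ c)

size-incs : ∀ (d : Fin k) n c → size (incs d n c) ≡ n + size c
size-incs d zero    c = refl
size-incs d (suc n) c = trans (size-incs d n (inc d ⨾ c)) (+-suc n (size c))

-- As in `incs`, the chain grows at its far end, next to the command that follows, so that existing
-- addresses are unaffected.
chainNumbers : Fin k → ℕ → List ℕ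
chainNumbers d zero    = []
chainNumbers d (suc n) = chainNumbers d n ++ numbers (2 + n) (inc d (3 + n))

commandNumbers-inc : ∀ (d : Fin k) c b e →
  commandNumbers (inc d ⨾ c) b e ≡ numbers b (inc d (suc b)) ++ commandNumbers c (suc b) e
commandNumbers-inc d c b e =
  trans (concatMap-allFin _ (λ j → numbers (b + toℕ j) (code (inc d ⨾ c) (λ j → b + toℕ j) e j)))
        (cong₂ _++_ (cong₂ (λ x y → numbers x (inc d y)) (+-identityʳ b) shift-entry)
                    (concatMap-cong (λ j → cong₂ numbers (+-suc b (toℕ j)) (shift j)) (allFin (size c))))
  where
  shift-entry : b + suc (toℕ (entry c)) ≡ suc b
  shift-entry = trans (cong (λ x → b + suc x) (toℕ-entry c)) (+-comm b 1)
  mapInstr-id : (i : Instr _ ℕ) → mapInstr id i ≡ i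
  mapInstr-id (inc r b)    = refl
  mapInstr-id (dec r b)    = refl
  mapInstr-id (test r b c) = refl
  mapInstr-id (jump b)     = refl
  mapInstr-id (reset b)    = refl
  shift : ∀ j → code c (λ j → b + suc (toℕ j)) e j ≡ code c (λ j → suc b + toℕ j) e j
  shift j = trans (sym (mapInstr-id _)) (code-map id c (λ i → +-suc b (toℕ i)) refl j)

commandNumbers-incs : ∀ (d : Fin k) n c e →
  commandNumbers (incs d n c) 2 e ≡ chainNumbers d n ++ commandNumbers c (2 + n) e
commandNumbers-incs d zero    c e = refl
commandNumbers-incs d (suc n) c e =
  trans (commandNumbers-incs d n (inc d ⨾ c) e)
  (trans (cong (chainNumbers d n ++_) (commandNumbers-inc d c (2 + n) e))
         (sym (++-assoc (chainNumbers d n) _ _)))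

-- A template describes the encoding of game (incs d N c) for all N at once.
data Item : Set where
  atom        : Atom → Item
  chain table : Item

module _ {k : ℕ} (d : Fin k) where

  itemNumbers : ℕ → Item → List ℕ
  itemNumbers N (atom a) = value N a ∷ []
  itemNumbers N chain    = chainNumbers d N
  itemNumbers N table    = replicate N 2

  instantiate : ℕ → List Item → List ℕ
  instantiate N = concatMap (itemNumbers N)

  constants : List ℕ → List Item
  constants xs = map (atom ∘ fixed) xs

  instantiate-atoms : ∀ N as → instantiate N (map atom as) ≡ map (value N) as
  instantiate-atoms N []       = refl
  instantiate-atoms N (a ∷ as) = cong (value N a ∷_) (instantiate-atoms N as)

  instantiate-constants : ∀ N xs → instantiate N (constants xs) ≡ xs
  instantiate-constants N []       = refl
  instantiate-constants N (x ∷ xs) = cong (x ∷_) (instantiate-constants N xs)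

  instantiate-++ : ∀ N xs ys {us vs} → instantiate N xs ≡ us → instantiate N ys ≡ vs →
                   instantiate N (xs ++ ys) ≡ us ++ vs
  instantiate-++ N xs ys p q = trans (concatMap-++ (itemNumbers N) xs ys) (cong₂ _++_ p q)

  commandAtoms : Cmd k → List Atom
  commandAtoms c =
    concatMap (λ j → atoms (shifted (toℕ j)) (code c (shifted ∘ toℕ) (fixed 1) j)) (allFin (size c))

  value-commandAtoms : ∀ N c → map (value N) (commandAtoms c) ≡ commandNumbers c (2 + N) 1
  value-commandAtoms N c =
    trans (map-concatMap (value N) _ (allFin (size c)))
          (concatMap-cong (λ j → trans (value-atoms N (shifted (toℕ j)) (code c (shifted ∘ toℕ) (fixed 1) j))
             (cong (numbers (2 + N + toℕ j)) (code-map (value N) c (λ _ → refl) refl j))) (allFin (size c)))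

  -- The number of observations for each player and location.
  columns : ℕ
  columns = length (allVecs (nothing ∷ map just (allFin 1)) (card (⊤ {suc k})))

  row : ℕ → List ℕ
  row x = replicate columns x

  -- The priorities of `N + n` locations for one player. All of them are 2, so only their number
  -- matters and the part depending on `N` may be collected in `columns` copies of `table`.
  rows : ℕ → List Item
  rows n = replicate columns table ++ constants (replicate (n * columns) 2)

  -- In order: the end of the transitions of the first automaton, the second automaton with one
  -- location and no transitions, the two subsets, the maximal priority, and the priorities of
  -- supply and restart for `P₀`.
  middle : List ℕ
  middle = 0 ∷ 1 ∷ 0 ∷ 0 ∷ encodeSubset (∅ {1}) ++ encodeSubset (⊤ {suc k}) ++ 2 ∷ row 2 ++ row 1

  template : Cmd k → List Item
  template c =
    constants (suc k ∷ 1 ∷ 1 ∷ 0 ∷ []) ++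
    -- This is the number of locations, `2 + N + size c`.
    atom (shifted (size c)) ∷
    constants (0 ∷ encodeItems encodeTransition (supply c) ++ numbers 1 (reset {k} 2)) ++
    chain ∷
    map atom (commandAtoms c) ++
    constants middle ++
    -- The remaining locations for `P₀`, then all locations for `P₁`.
    rows (size c) ++ constants (row 2 ++ row 2) ++ rows (size c)

  -- Instantiating the template yields the encoding

  replicate-sum : ∀ m n (x : A) → replicate (m + n) x ≡ replicate m x ++ replicate n x
  replicate-sum zero    n x = refl
  replicate-sum (suc m) n x = cong (x ∷_) (replicate-sum m n x)

  concatMap-const : ∀ (xs : List A) m (y : B) {f} → (∀ x → f x ≡ replicate m y) →
                    concatMap f xs ≡ replicate (length xs * m) y
  concatMap-const []       m y p = refl
  concatMap-const (x ∷ xs) m y p =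
    trans (cong₂ _++_ (p x) (concatMap-const xs m y p)) (sym (replicate-sum m _ y))

  instantiate-tables : ∀ N m → instantiate N (replicate m table) ≡ replicate (m * N) 2
  instantiate-tables N zero    = refl
  instantiate-tables N (suc m) =
    trans (cong (replicate N 2 ++_) (instantiate-tables N m)) (sym (replicate-sum N (m * N) 2))

  instantiate-rows : ∀ N n → instantiate N (rows n) ≡ replicate ((N + n) * columns) 2
  instantiate-rows N n = begin
    instantiate N (rows n)
      ≡⟨ instantiate-++ N (replicate columns table) _ (instantiate-tables N columns)
                        (instantiate-constants N (replicate (n * columns) 2)) ⟩
    replicate (columns * N) 2 ++ replicate (n * columns) 2
      ≡⟨ replicate-sum (columns * N) (n * columns) 2 ⟨
    replicate (columns * N + n * columns) 2
      ≡⟨ cong (λ x → replicate x 2) (cong (_+ n * columns) (*-comm columns N)) ⟩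
    replicate (N * columns + n * columns) 2
      ≡⟨ cong (λ x → replicate x 2) (*-distribʳ-+ columns N n) ⟨
    replicate ((N + n) * columns) 2 ∎
    where open ≡-Reasoning

  module _ (c : Cmd k) where

    private
      G : ParityGame
      G = game c
      open ParityGame G using (Obs; HObs; 𝒜₀)
      headings : List HObs
      headings = allVecs (nothing ∷ map just (allFin 1)) (card (⊤ {suc k}))

    priorities : List Obs → List ℕ
    priorities = concatMap (λ o → encodeFin (priority c o))

    priorities-row : ∀ p q x → (∀ h → toℕ (priority c (p , q , h)) ≡ x) →
                     priorities (map (λ h → p , q , h) headings) ≡ row x
    priorities-row p q x eq =
      trans (concatMap-map (λ o → encodeFin (priority c o)) (λ h → p , q , h) headings)
      (trans (concatMap-const headings 1 x (λ h → cong (_∷ []) (eq h)))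
             (cong (λ n → replicate n x) (*-identityʳ columns)))

    priorities-rows : ∀ p x y →
      (∀ h → toℕ (priority c (p , zero , h)) ≡ x) →
      (∀ h → toℕ (priority c (p , suc zero , h)) ≡ y) →
      (∀ q h → toℕ (priority c (p , suc (suc q) , h)) ≡ 2) →
      priorities (concatMap (λ q → map (λ h → p , q , h) headings) (allFin (2 + size c))) ≡
      row x ++ row y ++ replicate (size c * columns) 2
    priorities-rows p x y p₀ p₁ p₂ = begin
      priorities (concatMap (λ q → map (λ h → p , q , h) headings) (allFin (2 + size c)))
        ≡⟨ concatMap-concatMap _ (λ q → map (λ h → p , q , h) headings) (allFin (2 + size c)) ⟩
      concatMap f (allFin (2 + size c))
        ≡⟨ concatMap-allFin (suc (size c)) f ⟩
      f zero ++ concatMap (f ∘ suc) (allFin (suc (size c)))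
        ≡⟨ cong (f zero ++_) (concatMap-allFin (size c) (f ∘ suc)) ⟩
      f zero ++ f (suc zero) ++ concatMap (λ q → f (suc (suc q))) (allFin (size c))
        ≡⟨ cong₂ _++_ (priorities-row p zero x p₀) (cong₂ _++_ (priorities-row p (suc zero) y p₁)
            (trans (concatMap-const (allFin (size c)) columns 2 (λ q → priorities-row p (suc (suc q)) 2 (p₂ q)))
                   (cong (λ n → replicate (n * columns) 2) (length-tabulate {n = size c} id)))) ⟩
      row x ++ row y ++ replicate (size c * columns) 2 ∎
      where
      open ≡-Reasoning
      f : Fin (2 + size c) → List ℕ
      f q = priorities (map (λ h → p , q , h) headings)

    priorities-table : priorities (allObs (structure c)) ≡
      (row 2 ++ row 1 ++ replicate (size c * columns) 2) ++
      (row 2 ++ row 2 ++ replicate (size c * columns) 2)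
    priorities-table = begin
      priorities (block P₀ ++ block P₁ ++ [])
        ≡⟨ cong (λ xs → priorities (block P₀ ++ xs)) (++-identityʳ (block P₁)) ⟩
      priorities (block P₀ ++ block P₁)
        ≡⟨ concatMap-++ (λ o → encodeFin (priority c o)) (block P₀) (block P₁) ⟩
      priorities (block P₀) ++ priorities (block P₁)
        ≡⟨ cong₂ _++_ (priorities-rows P₀ 2 1 (λ _ → refl) (λ _ → refl) (λ _ _ → refl))
                      (priorities-rows P₁ 2 2 (λ _ → refl) (λ _ → refl) (λ _ _ → refl)) ⟩
      _ ∎
      where
      open ≡-Reasoning
      block : Player → List Obs
      block p = concatMap (λ q → map (λ h → p , q , h) headings) (allFin (2 + size c))

  subsets : List ℕ
  subsets = encodeSubset (∅ {1}) ++ encodeSubset (⊤ {suc k})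

  reassociate : ∀ (s r ch m x y u v z a b t : List ℕ) →
    (s ++ r) ++ ch ++ m ++ (x ++ y ++ u ++ v ++ z ++ a ++ b) ++ t ++ (a ++ a) ++ t ≡
    ((s ++ r ++ ch ++ m) ++ x) ++ y ++ (u ++ v) ++ z ++ (a ++ b ++ t) ++ a ++ a ++ t
  reassociate s r ch m x y u v z a b t = solve (++-monoid ℕ)

  -- Both sides are brought to the list `normal`, where all dependence on `N` is explicit; what then
  -- remains is associativity.
  encode-game : ∀ N c → encodeParityGame (game (incs d N c)) ≡ instantiate N (template c)
  encode-game N c = trans lhs (sym rhs)
    where
    open ≡-Reasoning
    ic : Cmd k
    ic = incs d N c
    S R T Z : List ℕ
    S = encodeItems encodeTransition (supply c)
    R = numbers 1 (reset {k} 2)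
    T = replicate ((N + size c) * columns) 2
    Z = 1 ∷ 0 ∷ 0 ∷ subsets ++ 2 ∷ (row 2 ++ row 1 ++ T) ++ (row 2 ++ row 2 ++ T)
    main : List ℕ
    main = commandNumbers c (2 + N) 1

    δs : List (Transition (suc k) 1 1 (2 + size ic))
    δs = concatMap (λ a → transitions suc a (program ic a)) (allFin _)

    δ-list : encodeList encodeTransition (supply ic ++ δs) ≡
             (S ++ R ++ chainNumbers d N ++ main) ++ 0 ∷ []
    δ-list = trans (encodeList-items encodeTransition (supply ic ++ δs)) (cong (_++ 0 ∷ [])
      (trans (concatMap-++ (λ x → 1 ∷ encodeTransition x) (supply ic) δs)
             (cong (S ++_) (trans (encode-δ ic) (cong (R ++_) (commandNumbers-incs d N c 1))))))

    priority-rows : ℕ → List ℕ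
    priority-rows n = (row 2 ++ row 1 ++ replicate (n * columns) 2) ++
                      (row 2 ++ row 2 ++ replicate (n * columns) 2)

    normal : List ℕ
    normal = suc k ∷ 1 ∷ 1 ∷ 0 ∷ (2 + N + size c) ∷ 0 ∷
             ((S ++ R ++ chainNumbers d N ++ main) ++ 0 ∷ []) ++ Z

    lhs : encodeParityGame (game ic) ≡ normal
    lhs = cong₂ (λ x y → suc k ∷ 1 ∷ 1 ∷ 0 ∷ (2 + x) ∷ 0 ∷ y) (size-incs d N c)
      (cong₂ (λ x y → x ++ 1 ∷ 0 ∷ 0 ∷ y) δ-list
        (trans (cong (λ x → encodeSubset (∅ {1}) ++ encodeSubset (⊤ {suc k}) ++ 2 ∷ x)
                 (trans (priorities-table ic) (cong priority-rows (size-incs d N c))))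
               (sym (++-assoc (encodeSubset (∅ {1})) (encodeSubset (⊤ {suc k}))
                              (2 ∷ priority-rows (N + size c))))))

    rhs : instantiate N (template c) ≡ normal
    rhs = cong (λ xs → suc k ∷ 1 ∷ 1 ∷ 0 ∷ (2 + N + size c) ∷ 0 ∷ xs) (trans
      (instantiate-++ N (constants (S ++ R)) _ (instantiate-constants N (S ++ R))
      (cong (chainNumbers d N ++_)
      (instantiate-++ N (map atom (commandAtoms c)) _
        (trans (instantiate-atoms N (commandAtoms c)) (value-commandAtoms N c))
      (instantiate-++ N (constants middle) _ (instantiate-constants N middle)
      (instantiate-++ N (rows (size c)) _ (instantiate-rows N (size c))
      (instantiate-++ N (constants (row 2 ++ row 2)) _ (instantiate-constants N (row 2 ++ row 2))
                      (instantiate-rows N (size c))))))))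
      (reassociate S R (chainNumbers d N) main (0 ∷ []) (1 ∷ 0 ∷ 0 ∷ []) (encodeSubset (∅ {1}))
                   (encodeSubset (⊤ {suc k})) (2 ∷ []) (row 2) (row 1) T))

  encode-template : ∀ N c → encode (game (incs d N c)) ≡ bits (instantiate N (template c))
  encode-template N c = cong bits (encode-game N c)

-- Programming

-- `T` is scratch space, `X` the symbol to be pushed or just popped, `F` a flag for popping. `I` and
-- `J` are loop counters and, during the simulation, the control state and a flag that is 1 while
-- the machine runs. `D` holds `N`.
T X F I J D : Fin 8
T = 0F
X = 1F
F = 2F
I = 3F
J = 4F
D = 5F

stack : Direction → Fin 8
stack left  = 6F
stack right = 7F

opposite : Direction → Direction
opposite left  = right
opposite right = left

private variable
  t x f i j d a b m n : ℕ
  s : Direction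
  ws : Vec ℕ 2

-- a is the content of stack s and b that of the other stack.
stacks : Direction → ℕ → ℕ → Vec ℕ 2
stacks left  a b = a ∷ b ∷ []
stacks right a b = b ∷ a ∷ []

st : ℕ → ℕ → ℕ → ℕ → ℕ → ℕ → Direction → ℕ → ℕ → Regs 8
st t x f i j d s a b = t ∷ x ∷ f ∷ i ∷ j ∷ d ∷ stacks s a b

lookup-stack : ∀ s → lookup (st t x f i j d s a b) (stack s) ≡ a
lookup-stack left  = refl
lookup-stack right = refl

inc-stack : ∀ s → inc (stack s) ⊢ st t x f i j d s a b ⇓ st t x f i j d s (suc a) b
inc-stack left  = inc
inc-stack right = inc

dec-stack : ∀ s → dec (stack s) ⊢ st t x f i j d s (suc a) b ⇓ st t x f i j d s a b
dec-stack left  = dec refl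
dec-stack right = dec refl

-- Stack operations

restore : Direction → Cmd 8
restore s = while T (dec T ⨾ inc (stack s))

restore-⇓ : ∀ s t → t + a ≡ n → restore s ⊢ st t x f i j d s a b ⇓ st 0 x f i j d s n b
restore-⇓ s zero    refl = done refl
restore-⇓ s (suc t) p    =
  loop refl (dec refl ⨾ inc-stack s) (restore-⇓ s t (trans (+-suc t _) p))

dbl : ℕ → ℕ
dbl zero    = zero
dbl (suc n) = suc (suc (dbl n))

double : Direction → Cmd 8
double s = while (stack s) (dec (stack s) ⨾ inc T ⨾ inc T) ⨾ restore s

double-⇓ : ∀ s a → double s ⊢ st 0 x f i j d s a b ⇓ st 0 x f i j d s (dbl a) b
double-⇓ s a = go a (+-identityʳ (dbl a)) ⨾ restore-⇓ s (dbl a) (+-identityʳ (dbl a))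
  where
  go : ∀ a → dbl a + t ≡ n → while (stack s) (dec (stack s) ⨾ inc T ⨾ inc T) ⊢
       st t x f i j d s a b ⇓ st n x f i j d s 0 b
  go zero    refl = done (lookup-stack s)
  go (suc a) p    = loop (lookup-stack s) (dec-stack s ⨾ inc ⨾ inc)
    (go a (trans (trans (+-suc (dbl a) _) (cong suc (+-suc (dbl a) _))) p))

shift : ℕ → ℕ → ℕ
shift zero    a = a
shift (suc x) a = shift x (dbl a)

shift-dbl : ∀ x a → shift x (dbl a) ≡ dbl (shift x a)
shift-dbl zero    a = refl
shift-dbl (suc x) a = shift-dbl x (dbl a)

shift-suc : ∀ x a → ∃[ n ] shift x (suc a) ≡ suc n
shift-suc zero    a = a , refl
shift-suc (suc x) a = shift-suc x (suc (dbl a))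

-- A stack is a number: pushing x turns n into 2ˣ (2n + 1), where 2ˣ a is shift x a.
cons : ℕ → ℕ → ℕ
cons x n = shift x (suc (dbl n))

number : List ℕ → ℕ
number []       = 0
number (x ∷ xs) = cons x (number xs)

push : Direction → Cmd 8
push s = double s ⨾ inc (stack s) ⨾ while X (dec X ⨾ double s)

push-⇓ : ∀ s x a → push s ⊢ st 0 x f i j d s a b ⇓ st 0 0 f i j d s (cons x a) b
push-⇓ s x a = double-⇓ s a ⨾ inc-stack s ⨾ go x (suc (dbl a))
  where
  go : ∀ x a → while X (dec X ⨾ double s) ⊢ st 0 x f i j d s a b ⇓ st 0 0 f i j d s (shift x a) b
  go zero    a = done refl
  go (suc x) a = loop refl (dec refl ⨾ double-⇓ s a) (go x (dbl a))

-- Register F is cleared when the number to be halved turns out to be odd.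
split : Direction → Cmd 8
split s = while (stack s) (dec (stack s) ⨾ if+ (stack s) (dec (stack s) ⨾ inc T) (dec F))

halve : Direction → Cmd 8
halve s = split s ⨾ restore s ⨾ if+ F (inc X) skip

-- The halvings before an odd number appears are counted in `X`. The empty stack is treated apart
-- because 0 could be halved forever.
pop : Direction → Cmd 8
pop s = if+ (stack s) (inc F ⨾ while F (halve s)) skip

halve-even : ∀ s a → halve s ⊢ st 0 x 1 i j d s (dbl a) b ⇓ st 0 (suc x) 1 i j d s a b
halve-even s a = go a (+-identityʳ a) ⨾ restore-⇓ s a (+-identityʳ a) ⨾ if-pos refl inc
  where
  go : ∀ a → a + t ≡ n → split s ⊢ st t x 1 i j d s (dbl a) b ⇓ st n x 1 i j d s 0 b
  go zero    refl = done (lookup-stack s)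
  go (suc a) p    = loop (lookup-stack s)
    (dec-stack s ⨾ if-pos (lookup-stack s) (dec-stack s ⨾ inc)) (go a (trans (+-suc a _) p))

halve-odd : ∀ s a → halve s ⊢ st 0 x 1 i j d s (suc (dbl a)) b ⇓ st 0 x 0 i j d s a b
halve-odd s a = go a (+-identityʳ a) ⨾ restore-⇓ s a (+-identityʳ a) ⨾ if-zero refl skip
  where
  go : ∀ a → a + t ≡ n → split s ⊢ st t x 1 i j d s (suc (dbl a)) b ⇓ st n x 0 i j d s 0 b
  go zero    refl = loop (lookup-stack s) (dec-stack s ⨾ if-zero (lookup-stack s) (dec refl))
                         (done (lookup-stack s))
  go (suc a) p    = loop (lookup-stack s)
    (dec-stack s ⨾ if-pos (lookup-stack s) (dec-stack s ⨾ inc)) (go a (trans (+-suc a _) p))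

pop-empty : ∀ s → pop s ⊢ st 0 0 0 i j d s 0 b ⇓ st 0 0 0 i j d s 0 b
pop-empty s = if-zero (lookup-stack s) skip

pop-cons : ∀ s x a → pop s ⊢ st 0 0 0 i j d s (cons x a) b ⇓ st 0 x 0 i j d s a b
pop-cons s x a = if-pos (trans (lookup-stack s) (proj₂ (shift-suc x (dbl a)))) (inc ⨾ go x (+-identityʳ x))
  where
  go : ∀ x {y} → x + y ≡ n → while F (halve s) ⊢ st 0 y 1 i j d s (cons x a) b ⇓ st 0 n 0 i j d s a b
  go zero    refl = loop refl (halve-odd s a) (done refl)
  go (suc x) p rewrite shift-dbl x (suc (dbl a)) =
    loop refl (halve-even s (cons x a)) (go x (trans (+-suc x _) p))

switch : Fin 8 → (n : ℕ) → (Fin n → Cmd 8) → Cmd 8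
switch r zero    c = skip
switch r (suc n) c = if+ r (dec r ⨾ switch r n (λ i → c (suc i))) (c zero)

switch-X : ∀ {n w} (c : Fin n → Cmd 8) (y : Fin n) → c y ⊢ t ∷ 0 ∷ f ∷ i ∷ j ∷ d ∷ ws ⇓ w →
           switch X n c ⊢ t ∷ (toℕ y) ∷ f ∷ i ∷ j ∷ d ∷ ws ⇓ w
switch-X c zero    p = if-zero refl p
switch-X c (suc y) p = if-pos refl (dec refl ⨾ switch-X (λ i → c (suc i)) y p)

switch-I : ∀ {n w} (c : Fin n → Cmd 8) (y : Fin n) → c y ⊢ t ∷ x ∷ f ∷ 0 ∷ j ∷ d ∷ ws ⇓ w →
           switch I n c ⊢ t ∷ x ∷ f ∷ (toℕ y) ∷ j ∷ d ∷ ws ⇓ w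
switch-I c zero    p = if-zero refl p
switch-I c (suc y) p = if-pos refl (dec refl ⨾ switch-I (λ i → c (suc i)) y p)

incs-X : ∀ n {c w} → c ⊢ t ∷ (n + x) ∷ f ∷ i ∷ j ∷ d ∷ ws ⇓ w →
         incs X n c ⊢ t ∷ x ∷ f ∷ i ∷ j ∷ d ∷ ws ⇓ w
incs-X zero    p = p
incs-X (suc n) p = incs-X n (inc ⨾ p)

incs-I : ∀ n {c w} → c ⊢ t ∷ x ∷ f ∷ (n + i) ∷ j ∷ d ∷ ws ⇓ w →
         incs I n c ⊢ t ∷ x ∷ f ∷ i ∷ j ∷ d ∷ ws ⇓ w
incs-I zero    p = p
incs-I (suc n) p = incs-I n (inc ⨾ p)

incs-D : ∀ n {c w} → c ⊢ t ∷ x ∷ f ∷ i ∷ j ∷ (n + d) ∷ ws ⇓ w →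
         incs D n c ⊢ t ∷ x ∷ f ∷ i ∷ j ∷ d ∷ ws ⇓ w
incs-D zero    p = p
incs-D (suc n) p = incs-D n (inc ⨾ p)

-- Writing words on the right stack

-- These codes agree with `symbolCode` of the simulation below, so the word written is directly a
-- tape; 0 is left for the blank.
bitCode : Bool → ℕ
bitCode false = 1
bitCode true  = 2

word : List Bool → ℕ
word u = number (map bitCode u)

emit : List Bool → Cmd 8
emit []      = skip
emit (c ∷ w) = emit w ⨾ incs X (bitCode c) (push right)

wr : ℕ → ℕ → ℕ → List Bool → ℕ → Regs 8
wr i j d u b = st 0 0 0 i j d right (word u) b

emit-⇓ : ∀ w u → emit w ⊢ wr i j d u b ⇓ wr i j d (w ++ u) b
emit-⇓ []          u = skip
emit-⇓ (false ∷ w) u = emit-⇓ w u ⨾ incs-X 1 (push-⇓ right 1 _)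
emit-⇓ (true  ∷ w) u = emit-⇓ w u ⨾ incs-X 2 (push-⇓ right 2 _)

times : ℕ → List Bool → List Bool → List Bool
times zero    w u = u
times (suc n) w u = times n w (w ++ u)

times-concat : ∀ n w u → times n w u ≡ concat (replicate n w) ++ u
times-concat zero    w u = refl
times-concat (suc n) w u = trans (times-concat n w (w ++ u))
  (trans (sym (++-assoc (concat (replicate n w)) w u)) (cong (_++ u) (comm n)))
  where
  comm : ∀ n → concat (replicate n w) ++ w ≡ w ++ concat (replicate n w)
  comm zero    = sym (++-identityʳ w)
  comm (suc n) = trans (++-assoc w _ w) (cong (w ++_) (comm n))

times-true : ∀ n u → times n (true ∷ []) u ≡ replicate n true ++ u
times-true n u = trans (times-concat n _ u) (cong (_++ u) (go n))
  where
  go : ∀ n → concat (replicate n (true ∷ [])) ≡ replicate n true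
  go zero    = refl
  go (suc n) = cong (true ∷_) (go n)

-- `D` is restored by way of `J`, because each symbol of the template that depends on `N` reads it
-- anew.
copy : Cmd 8
copy = while D (dec D ⨾ inc I ⨾ inc J) ⨾ while J (dec J ⨾ inc D)

copy-⇓ : ∀ d → copy ⊢ t ∷ x ∷ f ∷ 0 ∷ 0 ∷ d ∷ ws ⇓ t ∷ x ∷ f ∷ d ∷ 0 ∷ d ∷ ws
copy-⇓ d = go d (+-identityʳ d) (+-identityʳ d) ⨾ back d (+-identityʳ d)
  where
  go : ∀ d → d + i ≡ m → d + j ≡ n → while D (dec D ⨾ inc I ⨾ inc J) ⊢
       t ∷ x ∷ f ∷ i ∷ j ∷ d ∷ ws ⇓ t ∷ x ∷ f ∷ m ∷ n ∷ 0 ∷ ws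
  go zero    refl refl = done refl
  go (suc d) p q = loop refl (dec refl ⨾ inc ⨾ inc) (go d (trans (+-suc d _) p) (trans (+-suc d _) q))
  back : ∀ j {e} → j + e ≡ n → while J (dec J ⨾ inc D) ⊢
         t ∷ x ∷ f ∷ i ∷ j ∷ e ∷ ws ⇓ t ∷ x ∷ f ∷ i ∷ 0 ∷ n ∷ ws
  back zero    refl = done refl
  back (suc j) p    = loop refl (dec refl ⨾ inc) (back j (trans (+-suc j _) p))

eachI : List Bool → Cmd 8
eachI w = while I (dec I ⨾ emit w)

eachI-⇓ : ∀ i w u → eachI w ⊢ wr i j d u b ⇓ wr 0 j d (times i w u) b
eachI-⇓ zero    w u = done refl
eachI-⇓ (suc i) w u = loop refl (dec refl ⨾ emit-⇓ w u) (eachI-⇓ i w (w ++ u))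

ones : Cmd 8
ones = while I (dec I ⨾ inc J ⨾ emit (true ∷ [])) ⨾ while J (dec J ⨾ inc I)

ones-⇓ : ∀ i u → ones ⊢ wr i 0 d u b ⇓ wr i 0 d (replicate i true ++ u) b
ones-⇓ {d} {b} i u =
  subst (λ u′ → ones ⊢ wr i 0 d u b ⇓ wr i 0 d u′ b) (times-true i u)
        (go i u (+-identityʳ i) ⨾ back i (+-identityʳ i))
  where
  go : ∀ i u → i + j ≡ n → while I (dec I ⨾ inc J ⨾ emit (true ∷ [])) ⊢
       wr i j d u b ⇓ wr 0 n d (times i (true ∷ []) u) b
  go zero    u refl = done refl
  go (suc i) u p    = loop refl (dec refl ⨾ inc ⨾ emit-⇓ (true ∷ []) u) (go i (true ∷ u) (trans (+-suc i _) p))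
  back : ∀ j {i} → j + i ≡ n → while J (dec J ⨾ inc I) ⊢
         t ∷ x ∷ f ∷ i ∷ j ∷ d ∷ ws ⇓ t ∷ x ∷ f ∷ n ∷ 0 ∷ d ∷ ws
  back zero    refl = done refl
  back (suc j) p    = loop refl (dec refl ⨾ inc) (back j (trans (+-suc j _) p))

-- The transition from location 2 + i that increments D is written
-- before ++ 1ⁱ ++ between fields ++ 1ⁱ ++ after.
fields : List ℕ
fields = encodeVec encodeGuard (guards {9}) ++ encodeVec encodeOp (recv zero ∷ (nops {8} [ D ]≔ send zero))

before after : List Bool
before = true ∷ false ∷ true ∷ true ∷ []
after  = false ∷ []

between : List ℕ → List Bool
between ns = false ∷ bits (0 ∷ ns) ++ true ∷ true ∷ true ∷ []

cell : List ℕ → Cmd 8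
cell ns = emit after ⨾ ones ⨾ emit (between ns) ⨾ ones ⨾ emit before

cell-⇓ : ∀ ns i u → cell ns ⊢ wr i 0 d u b ⇓
         wr i 0 d (before ++ replicate i true ++ between ns ++ replicate i true ++ after ++ u) b
cell-⇓ ns i u = emit-⇓ after u ⨾ ones-⇓ i u₁ ⨾ emit-⇓ (between ns) u₂ ⨾ ones-⇓ i u₃ ⨾ emit-⇓ before u₄
  where
  u₁ u₂ u₃ u₄ : List Bool
  u₁ = after ++ u
  u₂ = replicate i true ++ u₁
  u₃ = between ns ++ u₂
  u₄ = replicate i true ++ u₃

replicate-∷ʳ : ∀ n (u : List Bool) → (replicate n true ∷ʳ false) ++ u ≡ replicate n true ++ false ∷ u
replicate-∷ʳ n u = ++-assoc (replicate n true) (false ∷ []) u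

cell-bits : ∀ ns i u →
  bits (1 ∷ 2 + i ∷ 0 ∷ ns ++ 3 + i ∷ []) ++ u ≡
  before ++ replicate i true ++ between ns ++ replicate i true ++ after ++ u
cell-bits ns i u = cong (before ++_) (begin
  ((replicate i true ∷ʳ false) ++ bits (0 ∷ ns ++ 3 + i ∷ [])) ++ u
    ≡⟨ cong (_++ u) (replicate-∷ʳ i _) ⟩
  (replicate i true ++ false ∷ bits (0 ∷ ns ++ 3 + i ∷ [])) ++ u
    ≡⟨ ++-assoc (replicate i true) _ u ⟩
  replicate i true ++ false ∷ bits (0 ∷ ns ++ 3 + i ∷ []) ++ u
    ≡⟨ cong (λ w → replicate i true ++ false ∷ w ++ u) (bits-++ (0 ∷ ns) (3 + i ∷ [])) ⟩
  replicate i true ++ false ∷ (bits (0 ∷ ns) ++ bits (3 + i ∷ [])) ++ u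
    ≡⟨ cong (λ w → replicate i true ++ false ∷ w) (++-assoc (bits (0 ∷ ns)) _ u) ⟩
  replicate i true ++ false ∷ bits (0 ∷ ns) ++ bits (3 + i ∷ []) ++ u
    ≡⟨ cong (λ w → replicate i true ++ false ∷ bits (0 ∷ ns) ++ true ∷ true ∷ true ∷ w)
            (trans (cong (_++ u) (++-identityʳ (replicate i true ∷ʳ false))) (replicate-∷ʳ i u)) ⟩
  replicate i true ++ false ∷ bits (0 ∷ ns) ++ (true ∷ true ∷ true ∷ []) ++ replicate i true ++ after ++ u
    ≡⟨ cong (λ w → replicate i true ++ false ∷ w) (++-assoc (bits (0 ∷ ns)) (true ∷ true ∷ true ∷ []) _) ⟨
  replicate i true ++ between ns ++ replicate i true ++ after ++ u ∎)
  where open ≡-Reasoning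

-- `I` is decremented before `cell` runs, so the values are `N - 1` down to 0: the last transition
-- is pushed first, and the first ends on top.
chainLoop : Cmd 8
chainLoop = while I (dec I ⨾ cell fields)

chainLoop-⇓ : ∀ i u → chainLoop ⊢ wr i 0 d u b ⇓ wr 0 0 d (bits (chainNumbers {8} D i) ++ u) b
chainLoop-⇓ zero    u = done refl
chainLoop-⇓ {d} {b} (suc i) u = loop refl (dec refl ⨾ cell-⇓ fields i u)
  (subst (λ w → chainLoop ⊢ wr i 0 d w₀ b ⇓ wr 0 0 d w b) eq (chainLoop-⇓ i w₀))
  where
  w₀ : List Bool
  w₀ = before ++ replicate i true ++ between fields ++ replicate i true ++ after ++ u
  ns : List ℕ
  ns = numbers (2 + i) (inc {8} D (3 + i))
  ns-fields : ns ≡ 1 ∷ 2 + i ∷ 0 ∷ fields ++ 3 + i ∷ []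
  ns-fields = refl
  eq : bits (chainNumbers {8} D i) ++ w₀ ≡ bits (chainNumbers {8} D (suc i)) ++ u
  eq = begin
    bits (chainNumbers {8} D i) ++ w₀
      ≡⟨ cong (bits (chainNumbers {8} D i) ++_) (cell-bits fields i u) ⟨
    bits (chainNumbers {8} D i) ++ bits (1 ∷ 2 + i ∷ 0 ∷ fields ++ 3 + i ∷ []) ++ u
      ≡⟨ cong (λ ns → bits (chainNumbers {8} D i) ++ bits ns ++ u) ns-fields ⟨
    bits (chainNumbers {8} D i) ++ bits ns ++ u
      ≡⟨ ++-assoc (bits (chainNumbers {8} D i)) (bits ns) u ⟨
    (bits (chainNumbers {8} D i) ++ bits ns) ++ u
      ≡⟨ cong (_++ u) (bits-++ (chainNumbers {8} D i) ns) ⟨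
    bits (chainNumbers {8} D (suc i)) ++ u ∎
    where open ≡-Reasoning

-- Expanding a template

expand : ℕ → Fin 5 → List Bool
expand N 0F = false ∷ []
expand N 1F = true ∷ []
expand N 2F = replicate N true
expand N 3F = bits (chainNumbers {8} D N)
expand N 4F = bits (replicate N 2)

digitCmd : Fin 5 → Cmd 8
digitCmd 0F = emit (false ∷ [])
digitCmd 1F = emit (true ∷ [])
digitCmd 2F = copy ⨾ eachI (true ∷ [])
digitCmd 3F = copy ⨾ chainLoop
digitCmd 4F = copy ⨾ eachI (bits (2 ∷ []))

concat-bits : ∀ n x → concat (replicate n (bits (x ∷ []))) ≡ bits (replicate n x)
concat-bits zero    x = refl
concat-bits (suc n) x = cong₂ _++_ (++-identityʳ (replicate x true ∷ʳ false)) (concat-bits n x)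

digit-⇓ : ∀ y N u → digitCmd y ⊢ wr 0 0 N u b ⇓ wr 0 0 N (expand N y ++ u) b
digit-⇓ 0F N u = emit-⇓ (false ∷ []) u
digit-⇓ 1F N u = emit-⇓ (true ∷ []) u
digit-⇓ {b} 2F N u =
  copy-⇓ N ⨾ subst (λ w → eachI (true ∷ []) ⊢ wr N 0 N u b ⇓ wr 0 0 N w b)
                    (times-true N u) (eachI-⇓ N (true ∷ []) u)
digit-⇓ 3F N u = copy-⇓ N ⨾ chainLoop-⇓ N u
digit-⇓ {b} 4F N u =
  copy-⇓ N ⨾ subst (λ w → eachI (bits (2 ∷ [])) ⊢ wr N 0 N u b ⇓ wr 0 0 N w b)
    (trans (times-concat N (bits (2 ∷ [])) u) (cong (_++ u) (concat-bits N 2)))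
    (eachI-⇓ N (bits (2 ∷ [])) u)

-- The Gödel number. It is the very content of a stack holding `τ`, so decoding it takes only `pop`.
digits : List (Fin 5) → ℕ
digits τ = number (map toℕ τ)

expandAll : Cmd 8
expandAll = while (stack left) (pop left ⨾ switch X 5 digitCmd)

expansion : ℕ → List Bool → List (Fin 5) → List Bool
expansion N = foldl (λ u y → expand N y ++ u)

expandAll-⇓ : ∀ N τ u → expandAll ⊢ wr 0 0 N u (digits τ) ⇓ wr 0 0 N (expansion N u τ) 0
expandAll-⇓ N []      u = done refl
expandAll-⇓ N (y ∷ τ) u =
  loop (proj₂ (shift-suc (toℕ y) (dbl (digits τ))))
       (pop-cons left (toℕ y) (digits τ) ⨾ switch-X digitCmd y (digit-⇓ y N u))
       (expandAll-⇓ N τ (expand N y ++ u))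

expansion-reverse : ∀ N τ → expansion N [] (reverse τ) ≡ concatMap (expand N) τ
expansion-reverse N τ = trans (reverse-foldl (λ u y → expand N y ++ u) [] τ) (go τ)
  where
  go : ∀ τ → foldr (λ y u → expand N y ++ u) [] τ ≡ concatMap (expand N) τ
  go []      = refl
  go (y ∷ τ) = cong (expand N y ++_) (go τ)

itemDigits : Item → List (Fin 5)
itemDigits (atom (fixed a))   = replicate a 1F ++ 0F ∷ []
itemDigits (atom (shifted a)) = 1F ∷ 1F ∷ 2F ∷ replicate a 1F ++ 0F ∷ []
itemDigits chain              = 3F ∷ []
itemDigits table              = 4F ∷ []

expand-replicate : ∀ N a → concatMap (expand N) (replicate a 1F ++ 0F ∷ []) ≡ replicate a true ∷ʳ false
expand-replicate N zero    = refl
expand-replicate N (suc a) = cong (true ∷_) (expand-replicate N a)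

expand-item : ∀ N y → concatMap (expand N) (itemDigits y) ≡ bits (itemNumbers {8} D N y)
expand-item N (atom (fixed a))   = trans (expand-replicate N a) (sym (++-identityʳ _))
expand-item N (atom (shifted a)) = cong (λ w → true ∷ true ∷ w)
  (trans (cong (replicate N true ++_) (expand-replicate N a))
  (trans (sym (++-assoc (replicate N true) _ _))
  (trans (cong (_∷ʳ false) (go N)) (sym (++-identityʳ _)))))
  where
  go : ∀ N → replicate N true ++ replicate a true ≡ replicate (N + a) true
  go zero    = refl
  go (suc N) = cong (true ∷_) (go N)
expand-item N chain = ++-identityʳ (bits (chainNumbers {8} D N))
expand-item N table = ++-identityʳ (bits (replicate N 2))

expand-items : ∀ N ys → concatMap (expand N) (concatMap itemDigits ys) ≡ bits (instantiate {8} D N ys)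
expand-items N ys =
  trans (concatMap-concatMap (expand N) itemDigits ys)
  (trans (concatMap-cong (expand-item N) ys)
         (sym (concatMap-concatMap (λ n → replicate n true ∷ʳ false) (itemNumbers D N) ys)))

-- A word is pushed from its end to its beginning.
reversedDigits : List Item → List (Fin 5)
reversedDigits ys = reverse (concatMap itemDigits ys)

expansion-items : ∀ N ys → bits (instantiate {8} D N ys) ≡ expansion N [] (reversedDigits ys)
expansion-items N ys = trans (sym (expand-items N ys)) (sym (expansion-reverse N (concatMap itemDigits ys)))

-- Simulating a Turing machine

set-X : ∀ n {c w} → c ⊢ t ∷ n ∷ f ∷ i ∷ j ∷ d ∷ ws ⇓ w → incs X n c ⊢ t ∷ 0 ∷ f ∷ i ∷ j ∷ d ∷ ws ⇓ w
set-X {t} {f} {i} {j} {d} {ws} n {c} {w} p =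
  incs-X n (subst (λ y → c ⊢ t ∷ y ∷ f ∷ i ∷ j ∷ d ∷ ws ⇓ w) (sym (+-identityʳ n)) p)

set-I : ∀ n {c w} → c ⊢ t ∷ x ∷ f ∷ n ∷ j ∷ d ∷ ws ⇓ w → incs I n c ⊢ t ∷ x ∷ f ∷ 0 ∷ j ∷ d ∷ ws ⇓ w
set-I {t} {x} {f} {j} {d} {ws} n {c} {w} p =
  incs-I n (subst (λ y → c ⊢ t ∷ x ∷ f ∷ y ∷ j ∷ d ∷ ws ⇓ w) (sym (+-identityʳ n)) p)

set-D : ∀ n {c w} → c ⊢ t ∷ x ∷ f ∷ i ∷ j ∷ n ∷ ws ⇓ w → incs D n c ⊢ t ∷ x ∷ f ∷ i ∷ j ∷ 0 ∷ ws ⇓ w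
set-D {t} {x} {f} {i} {j} {ws} n {c} {w} p =
  incs-D n (subst (λ y → c ⊢ t ∷ x ∷ f ∷ i ∷ j ∷ y ∷ ws ⇓ w) (sym (+-identityʳ n)) p)

module Simulation (machine : TuringMachine) where

  open TuringMachine machine

  symbolCode : Γ → Fin (3 + extra)
  symbolCode blank       = 0F
  symbolCode (bit false) = 1F
  symbolCode (bit true)  = 2F
  symbolCode (aux i)     = suc (suc (suc i))

  symbol : Fin (3 + extra) → Γ
  symbol 0F                  = blank
  symbol 1F                  = bit false
  symbol 2F                  = bit true
  symbol (suc (suc (suc i))) = aux i

  symbol-code : ∀ y → symbol (symbolCode y) ≡ y
  symbol-code blank       = refl
  symbol-code (bit false) = refl
  symbol-code (bit true)  = refl
  symbol-code (aux i)     = refl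

  tape : List Γ → ℕ
  tape ys = number (map (toℕ ∘ symbolCode) ys)

  word-tape : ∀ u → word u ≡ tape (map bit u)
  word-tape []          = refl
  word-tape (false ∷ u) = cong (cons 1) (word-tape u)
  word-tape (true  ∷ u) = cong (cons 2) (word-tape u)

  -- A move pushes the written symbol on the stack opposite to its direction and pops the next
  -- scanned symbol from the other one. A verdict clears `J`, which ends the loop, and rejection is
  -- recorded by `X = 1`.
  act : Verdict ⊎ (Fin controls × Γ × Direction) → Cmd 8
  act (inj₁ accept)       = dec J
  act (inj₁ reject)       = dec J ⨾ inc X
  act (inj₂ (q , y , s)) =
    incs I (toℕ q) (incs X (toℕ (symbolCode y)) (push (opposite s) ⨾ pop s))

  read : Fin controls → Fin (3 + extra) → Cmd 8
  read q y = act (δ q (symbol y))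

  simulate : Cmd 8
  simulate = while J (switch I controls λ q → switch X (3 + extra) (read q))

  config : ℕ → TMConfig → Regs 8
  config N (q ◂ xs ◂ y ◂ ys) = st 0 (toℕ (symbolCode y)) 0 (toℕ q) 1 N right (tape ys) (tape xs)

  act-⇓ : ∀ N q xs y ys s → act (inj₂ (q , y , s)) ⊢ st 0 0 0 0 1 N right (tape ys) (tape xs) ⇓
          config N (move q xs y ys s)
  act-⇓ N q xs y ys s = set-I (toℕ q) (set-X (toℕ (symbolCode y)) (go xs ys s))
    where
    go : ∀ xs ys s → push (opposite s) ⨾ pop s ⊢
         st 0 (toℕ (symbolCode y)) 0 (toℕ q) 1 N right (tape ys) (tape xs) ⇓ config N (move q xs y ys s)
    -- Popping an empty stack leaves `X = 0`, the code of the blank.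
    go []       ys       left  = push-⇓ right _ (tape ys) ⨾ pop-empty left
    go (z ∷ xs) ys       left  = push-⇓ right _ (tape ys) ⨾ pop-cons left _ (tape xs)
    go []       []       right = push-⇓ left _ 0 ⨾ pop-empty right
    go []       (z ∷ ys) right = push-⇓ left _ 0 ⨾ pop-cons right _ (tape ys)
    go (x ∷ xs) []       right = push-⇓ left _ (tape (x ∷ xs)) ⨾ pop-empty right
    go (x ∷ xs) (z ∷ ys) right = push-⇓ left _ (tape (x ∷ xs)) ⨾ pop-cons right _ (tape ys)

  flag : Verdict → ℕ
  flag accept = 0
  flag reject = 1

  dispatch-⇓ : ∀ {N q y r w} → δ q y ≡ r → act r ⊢ st 0 0 0 0 1 N right a b ⇓ w →
    switch I controls (λ q → switch X (3 + extra) (read q)) ⊢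
    st 0 (toℕ (symbolCode y)) 0 (toℕ q) 1 N right a b ⇓ w
  dispatch-⇓ {a} {b} {N} {q} {y} {w = w} refl p =
    switch-I (λ q → switch X (3 + extra) (read q)) q (switch-X (read q) (symbolCode y)
    (subst (λ z → act (δ q z) ⊢ st 0 0 0 0 1 N right a b ⇓ w) (sym (symbol-code y)) p))

  simulate-⇓ : ∀ N {v cfg} → HaltsWith v cfg →
               ∃[ a ] ∃[ b ] simulate ⊢ config N cfg ⇓ st 0 (flag v) 0 0 0 N right a b
  simulate-⇓ N {accept} (halt e)   = _ , _ , loop refl (dispatch-⇓ e (dec refl)) (done refl)
  simulate-⇓ N {reject} (halt e)   = _ , _ , loop refl (dispatch-⇓ e (dec refl ⨾ inc)) (done refl)
  simulate-⇓ N (step {q} {xs} {x} {ys} {q′} {x′} {s} e h) with a , b , p ← simulate-⇓ N h =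
    a , b , loop refl (dispatch-⇓ e (act-⇓ N q′ xs x′ ys s)) p

  -- The program that runs the machine on its own game

  load : Cmd 8
  load = pop right ⨾ incs I (toℕ start) (inc J)

  load-⇓ : ∀ N u → load ⊢ wr 0 0 N u 0 ⇓ config N (initialConfig u)
  load-⇓ N []          = pop-empty right ⨾ set-I (toℕ start) inc
  load-⇓ N (false ∷ u) rewrite word-tape u = pop-cons right 1 (tape (map bit u)) ⨾ set-I (toℕ start) inc
  load-⇓ N (true  ∷ u) rewrite word-tape u = pop-cons right 2 (tape (map bit u)) ⨾ set-I (toℕ start) inc

  -- On the left stack `N` is read as the template, while `D` keeps it as the number to be inserted.
  duplicate : Cmd 8
  duplicate = copy ⨾ while I (dec I ⨾ inc (stack left))

  duplicate-⇓ : ∀ N → duplicate ⊢ wr 0 0 N [] 0 ⇓ wr 0 0 N [] N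
  duplicate-⇓ N = copy-⇓ N ⨾ go N (+-identityʳ N)
    where
    go : ∀ i {a} → i + a ≡ n → while I (dec I ⨾ inc (stack left)) ⊢ wr i 0 d [] a ⇓ wr 0 0 d [] n
    go zero    refl = done refl
    go (suc i) p    = loop refl (dec refl ⨾ inc) (go i (trans (+-suc i _) p))

  clear : Fin 8 → Cmd 8
  clear r = while r (dec r)

  clear-D : ∀ d → clear D ⊢ t ∷ x ∷ f ∷ i ∷ j ∷ d ∷ ws ⇓ t ∷ x ∷ f ∷ i ∷ j ∷ 0 ∷ ws
  clear-D zero    = done refl
  clear-D (suc d) = loop refl (dec refl) (clear-D d)

  clear-stack : ∀ s a → clear (stack s) ⊢ st t x f i j d s a b ⇓ st t x f i j d s 0 b
  clear-stack s zero    = done (lookup-stack s)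
  clear-stack s (suc a) = loop (lookup-stack s) (dec-stack s) (clear-stack s a)

  -- Everything that may be left over is cleared except `X`. So all registers are empty after
  -- acceptance, while after rejection `X = 1` blocks the restart.
  main : Cmd 8
  main = duplicate ⨾ expandAll ⨾ load ⨾ simulate ⨾ clear D ⨾ clear (stack right) ⨾ clear (stack left)

  main-⇓ : ∀ {N v} τ → N ≡ digits τ → HaltsWith v (initialConfig (expansion N [] τ)) →
           incs D N main ⊢ zeros ⇓ st 0 (flag v) 0 0 0 0 right 0 0
  main-⇓ {N} τ refl h with a , b , p ← simulate-⇓ N h =
    set-D N (duplicate-⇓ N ⨾ expandAll-⇓ N τ [] ⨾ load-⇓ N (expansion N [] τ) ⨾ p ⨾
             clear-D N ⨾ clear-stack right a ⨾ clear-stack left b)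

  -- Either verdict is wrong about this game. Acceptance makes the program return to the restart
  -- with empty registers, which gives a cycle and defeats every strategy; rejection leaves it stuck
  -- there, so the program terminates and the strategy wins.
  diagonal : ∀ ys {N u} → N ≡ digits (reversedDigits ys) → u ≡ bits (instantiate D N ys) →
    ¬ ((TuringMachine.Accepts machine u × HasConsistentWinningStrategy (game (incs D N main))) ⊎
       (TuringMachine.Rejects machine u × ¬ HasConsistentWinningStrategy (game (incs D N main))))
  diagonal ys {N} {u} p q = λ
    { (inj₁ (accepts , won))  → cycle⇒¬winning c (run accepts) won
    ; (inj₂ (rejects , ¬won)) → ¬won (terminating⇒winning c (run-terminates (program c) (run rejects) stuck)) }
    where
    c : Cmd 8
    c = incs D N main
    run : ∀ {v} → HaltsWith v (initialConfig u) →
          Run (program c) (suc (entry c)) zeros zero (st 0 (flag v) 0 0 0 0 right 0 0)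
    run {v} h = code-run (program c) c (λ _ → refl) (main-⇓ (reversedDigits ys) p
      (subst (λ u → HaltsWith v (initialConfig u)) (trans q (expansion-items N ys)) h))
    stuck : ∀ {A : Set} {a b : A} {w} → ¬ Exec {8} (reset a) (st 0 1 0 0 0 0 right 0 0) b w
    stuck ()

-- N is a variable here so that no closed encoding is ever normalised.
¬decides : ∀ machine N → N ≡ digits (reversedDigits (template D (Simulation.main machine))) →
           ¬ Decides machine encode HasConsistentWinningStrategy
¬decides machine N p decides =
  Simulation.diagonal machine (template D main) p (encode-template D N main) (decides (game (incs D N main)))
  where
  main : Cmd 8
  main = Simulation.main machine

mainTheorem3 : Undecidable encode HasConsistentWinningStrategy
mainTheorem3 (machine , decides) = ¬decides machine _ refl decides
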